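{- Fix $n$. No two non-isomorphic graphs in the family $\{K_n^{n_1,\ldots,n_k} : k\geq 2,\ n_i\geq 1,\ \sum_{i=1}^k n_i+1=n\}$ are $D$-cospectral.
   Context: All graphs are simple, undirected and connected. $D(G)$ is the distance matrix of $G$ (entries are shortest-path distances); two graphs are $D$-cospectral if their distance matrices have the same spectrum. For $k\geq 2$ and positive integers $n_1,\dots,n_k$ with $n=\sum n_i+1$, $K_n^{n_1,\ldots,n_k}$ is the graph with a vertex $v$ of degree $n-1$ such that $G-v$ is the disjoint union of complete graphs $K_{n_1},\dots,K_{n_k}$. -}

module Defs where

open import Data.Bool using (Bool; true; false; _∧_; _∨_; not; if_then_else_)
open import Data.Nat using (ℕ; zero; suc; _+_; _∸_; _≤_; _<ᵇ_; _≡ᵇ_; pred)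
open import Data.Fin using (Fin; toℕ; punchIn) renaming (zero to fzero; suc to fsuc)
open import Data.Fin.Properties using (_≟_)
open import Data.Integer using (ℤ; +_; -_) renaming (_+_ to _+ℤ_; _*_ to _*ℤ_)
open import Data.List using (List; []; _∷_; length; foldr; map; allFin)
open import Data.Bool.ListAction using (any)
open import Data.Nat.ListAction using (sum)
open import Data.List.Relation.Unary.All using (All)
open import Data.Product using (Σ; _×_; _,_)
open import Function.Bundles using (_↔_; Inverse)
open import Relation.Binary.PropositionalEquality using (_≡_; refl)
open import Relation.Nullary.Decidable using (⌊_⌋)

record SimpleGraph (n : ℕ) : Set where
  field
    adj   : Fin n → Fin n → Bool
    sym   : ∀ u v → adj u v ≡ adj v u
    irrefl : ∀ u → adj u u ≡ false
open SimpleGraph public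

Isomorphic : ∀ {n} → SimpleGraph n → SimpleGraph n → Set
Isomorphic {n} G H =
  Σ (Fin n ↔ Fin n) λ σ → ∀ u v → adj G u v ≡ adj H (Inverse.to σ u) (Inverse.to σ v)

reach : ∀ {n} → SimpleGraph n → ℕ → Fin n → Fin n → Bool
reach G zero    u v = ⌊ u ≟ v ⌋
reach {n} G (suc k) u v =
  reach G k u v ∨ any (λ w → reach G k u w ∧ adj G w v) (allFin n)

distSearch : ∀ {n} → SimpleGraph n → Fin n → Fin n → ℕ → ℕ → ℕ
distSearch G u v zero     k = k
distSearch G u v (suc f)  k = if reach G k u v then k else distSearch G u v f (suc k)

-- d(u,v) = length of a shortest u-v path (for connected graphs it is < n,
-- so fuel n suffices)
dist : ∀ {n} → SimpleGraph n → Fin n → Fin n → ℕ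
dist {n} G u v = distSearch G u v n 0

distMatrix : ∀ {n} → SimpleGraph n → Fin n → Fin n → ℤ
distMatrix G u v = + dist G u v

-- Integer polynomials as coefficient lists (lowest degree first)

Poly : Set
Poly = List ℤ

_+P_ : Poly → Poly → Poly
[]      +P q       = q
(a ∷ p) +P []      = a ∷ p
(a ∷ p) +P (b ∷ q) = (a +ℤ b) ∷ (p +P q)

scaleP : ℤ → Poly → Poly
scaleP a = map (a *ℤ_)

_*P_ : Poly → Poly → Poly
[]      *P q = []
(a ∷ p) *P q = scaleP a q +P (+ 0 ∷ (p *P q))

negP : Poly → Poly
negP = scaleP (- + 1)

coeff : Poly → ℕ → ℤ
coeff []      _       = + 0
coeff (a ∷ p) zero    = a
coeff (a ∷ p) (suc i) = coeff p i

det : ∀ {m} → (Fin m → Fin m → Poly) → Poly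
det {zero}  M = + 1 ∷ []
det {suc m} M =
  foldr _+P_ []
    (map (λ j → ((if ⌊ Data.Nat._≟_ (toℕ j Data.Nat.% 2) 0 ⌋ then (+ 1 ∷ []) else (- + 1 ∷ []))
                   *P M fzero j)
                 *P det (λ r c → M (fsuc r) (punchIn j c)))
         (allFin (suc m)))

charPoly : ∀ {m} → (Fin m → Fin m → ℤ) → Poly
charPoly M = det (λ i j → if ⌊ i ≟ j ⌋ then (- M i j ∷ + 1 ∷ []) else (- M i j ∷ []))

-- D-cospectral: distance matrices have the same spectrum (equivalently,
-- for real symmetric matrices, the same characteristic polynomial)
DCospectral : ∀ {n} → SimpleGraph n → SimpleGraph n → Set
DCospectral G H = ∀ i → coeff (charPoly (distMatrix G)) i ≡ coeff (charPoly (distMatrix H)) i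

-- The graphs K_n^{n_1,...,n_k}
-- Vertex 0 is the dominating vertex v; vertices 1..n-1 are split into
-- consecutive blocks of sizes n_1, ..., n_k, each block a clique.

blockOf : List ℕ → ℕ → ℕ
blockOf []       i = 0
blockOf (m ∷ ms) i = if i <ᵇ m then 0 else suc (blockOf ms (i ∸ m))

isZ : ℕ → Bool
isZ zero    = true
isZ (suc _) = false

adjK : ∀ {n} → List ℕ → Fin n → Fin n → Bool
adjK ps u v = not (toℕ u ≡ᵇ toℕ v) ∧
  (isZ (toℕ u) ∨ (isZ (toℕ v) ∨ (blockOf ps (pred (toℕ u)) ≡ᵇ blockOf ps (pred (toℕ v)))))

private
  ≡ᵇ-sym : ∀ a b → (a ≡ᵇ b) ≡ (b ≡ᵇ a)
  ≡ᵇ-sym zero zero = refl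
  ≡ᵇ-sym zero (suc b) = refl
  ≡ᵇ-sym (suc a) zero = refl
  ≡ᵇ-sym (suc a) (suc b) = ≡ᵇ-sym a b

  ≡ᵇ-refl : ∀ a → (a ≡ᵇ a) ≡ true
  ≡ᵇ-refl zero = refl
  ≡ᵇ-refl (suc a) = ≡ᵇ-refl a

  or-lemma : ∀ x y c d → c ≡ d → (x ∨ (y ∨ c)) ≡ (y ∨ (x ∨ d))
  or-lemma true  true  c d _ = refl
  or-lemma true  false c d _ = refl
  or-lemma false true  c d _ = refl
  or-lemma false false c .c refl = refl

  adjK-sym : ∀ {n} ps (u v : Fin n) → adjK ps u v ≡ adjK ps v u
  adjK-sym ps u v
    rewrite ≡ᵇ-sym (toℕ u) (toℕ v)
          | or-lemma (isZ (toℕ u)) (isZ (toℕ v))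
              (blockOf ps (pred (toℕ u)) ≡ᵇ blockOf ps (pred (toℕ v)))
              (blockOf ps (pred (toℕ v)) ≡ᵇ blockOf ps (pred (toℕ u)))
              (≡ᵇ-sym (blockOf ps (pred (toℕ u))) (blockOf ps (pred (toℕ v))))
    = refl

  adjK-irrefl : ∀ {n} ps (u : Fin n) → adjK ps u u ≡ false
  adjK-irrefl ps u rewrite ≡ᵇ-refl (toℕ u) = refl

K : (n : ℕ) → List ℕ → SimpleGraph n
K n ps = record { adj = adjK ps ; sym = adjK-sym ps ; irrefl = adjK-irrefl ps }

InFamily : ℕ → List ℕ → Set
InFamily n ps = (2 ≤ length ps) × All (1 ≤_) ps × (sum ps + 1 ≡ n)

{-# OPTIONS --safe #-}
-- Put y = x + 1 and N = n - 1.  Subtracting twice the column of v from the others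
-- turns x I - D into a bordering of the block matrix B = y I + (J_{n_1} ⊕ … ⊕ J_{n_k}),
-- and solving B w = (1, …, 1) gives the characteristic polynomial
--   (y - 1) T - (2 y - 1) U,  T = y^(N-k) ∏ (y + n_i),  U = y^(N-k) Σ n_i ∏_{j ≠ i} (y + n_j).
-- Since U = N T - y T′, its coefficient of y^(i+1) is
--   (1 - 2 (N - i)) t_i + (N - i - 2) t_{i+1},  where T = Σ t_i y^i,
-- and the odd factor of t_i never vanishes.  So the characteristic polynomial determines
-- T from the top coefficient down, hence the multiset of the n_i.
module Submission where

open import Defs
open import Data.Bool using (Bool; true; false; _∧_; _∨_; not; if_then_else_)
import Data.Bool.Properties as Bool
open import Data.Bool.ListAction using (any)
open import Data.Empty using (⊥)
open import Data.Fin as Fin using (Fin; zero; suc; toℕ; punchIn; punchOut; inject₁)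
open import Data.Fin.Induction using (<-weakInduction)
open import Data.Fin.Permutation using (lift₀)
import Data.Fin.Properties as Fin
open import Data.Integer using (ℤ; +_; _+_; _*_; -_; _^_; ∣_∣; 0ℤ; 1ℤ; ≢-nonZero)
import Data.Integer.Properties as ℤ
open import Data.Integer.Tactic.RingSolver using (solve-∀)
open import Data.List as List using (List; []; _∷_; _++_; length; replicate)
open import Data.List.Membership.Propositional using (_∈_)
open import Data.List.Membership.Propositional.Properties using (∈-∃++)
import Data.List.Properties as List
open import Data.List.Relation.Binary.Permutation.Propositional as Perm
  using (_↭_; ↭-sym; ↭-trans; ↭-reflexive; ↭-refl)
open import Data.List.Relation.Binary.Permutation.Propositional.Properties using (shift; filter-↭)
open import Data.List.Relation.Unary.All using (All; []; _∷_)
open import Data.List.Relation.Unary.Any using (here; there)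
open import Data.Nat as ℕ using (ℕ; zero; suc; _≤_; z≤n; s≤s; _∸_; _<ᵇ_; _≡ᵇ_; pred)
open import Data.Nat.ListAction using () renaming (sum to sumℕ)
import Data.Nat.Properties as ℕ
open import Data.Product using (Σ; ∃; _×_; _,_)
open import Data.Sum using (_⊎_; inj₁; inj₂)
open import Data.Sum.Function.Propositional using (_⊎-↔_)
open import Function using (_∘_; id)
open import Function.Bundles using (_↔_; Inverse; Injection; mk↔ₛ′)
open import Function.Properties.Inverse using (↔-refl; ↔-sym; ↔-trans; ↔⇒↣)
open import Relation.Binary.PropositionalEquality as ≡
  using (_≡_; _≢_; refl; trans; cong; cong₂; subst; module ≡-Reasoning)
open import Relation.Nullary using (Dec; yes; no; contradiction)
open import Relation.Nullary.Decidable using (⌊_⌋)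
open import Algebra.Properties.AbelianGroup ℤ.+-0-abelianGroup using ()
  renaming (∙-cancelʳ to +-cancelʳ)
open import Algebra.Properties.Semiring.Sum ℤ.+-*-semiring
  using (sum; sum-cong-≋; *-distribˡ-sum; ∑-distrib-+)
open ≡-Reasoning

-- Determinants over ℤ

-- Away from v the entries of D are 0, 1 or 2, and `x I − D` is `B − 2 J` there; the column of v is
-- constantly -1 on these rows, which is why subtracting it twice removes `2 J`. Two obstacles
-- remain: w has denominators `y + n_i`, and coefficient lists satisfy the ring laws only up to
-- trailing zeros. Both are met by evaluating at integers `y ≥ 1`. There T is nonzero, so the column
-- of v can be multiplied by T and the factor cancelled at the end, and agreement at all these
-- points forces equal coefficients. The power `y^(N-k)` is encoded as zero entries in the list of
-- sizes. T then has exactly N linear factors whatever k is, so lists with different k obey the same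
-- recursion. The relation for U is the sum of `a / (y + a) = 1 − y / (y + a)` over these N entries,
-- multiplied by T.

Matrix : ℕ → Set
Matrix m = Fin m → Fin m → ℤ

sgn : ℕ → ℤ
sgn zero    = 1ℤ
sgn (suc k) = - sgn k

minor : ∀ {m} → Matrix (suc m) → Fin (suc m) → Matrix m
minor M j r c = M (suc r) (punchIn j c)

detℤ : ∀ {m} → Matrix m → ℤ
detℤ {zero}  M = 1ℤ
detℤ {suc m} M = sum λ j → (sgn (toℕ j) * M zero j) * detℤ (minor M j)

detℤ-cong : ∀ {m} {A B : Matrix m} → (∀ i j → A i j ≡ B i j) → detℤ A ≡ detℤ B
detℤ-cong {zero}  A≗B = refl
detℤ-cong {suc m} A≗B = sum-cong-≋ λ j →
  cong₂ (λ a d → (sgn (toℕ j) * a) * d) (A≗B zero j) (detℤ-cong λ r c → A≗B (suc r) (punchIn j c))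

-- Expansion is along row 0, so column `c` enters a term either as the entry (`j ≡ c`, where the
-- minors agree) or as column `punchOut` of the minor, by induction. Having both `s` and `t` covers
-- additivity and scaling at once.
detℤ-linear : ∀ {m} (c : Fin m) (s t : ℤ) {A B C : Matrix m} →
  (∀ i j → j ≢ c → A i j ≡ C i j) → (∀ i j → j ≢ c → B i j ≡ C i j) →
  (∀ i → C i c ≡ s * A i c + t * B i c) →
  detℤ C ≡ s * detℤ A + t * detℤ B
detℤ-linear {suc m} c s t {A} {B} {C} A≗C B≗C Cc = begin
  sum (term C)
    ≡⟨ sum-cong-≋ term-linear ⟩
  sum (λ j → s * term A j + t * term B j)
    ≡⟨ ∑-distrib-+ (λ j → s * term A j) (λ j → t * term B j) ⟩
  sum (λ j → s * term A j) + sum (λ j → t * term B j)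
    ≡⟨ cong₂ _+_ (≡.sym (*-distribˡ-sum s (term A))) (≡.sym (*-distribˡ-sum t (term B))) ⟩
  s * sum (term A) + t * sum (term B) ∎
  where
  term : Matrix (suc m) → Fin (suc m) → ℤ
  term M j = (sgn (toℕ j) * M zero j) * detℤ (minor M j)

  entry-linear : ∀ σ s t a b d → (σ * (s * a + t * b)) * d ≡ s * ((σ * a) * d) + t * ((σ * b) * d)
  entry-linear = solve-∀

  minor-linear : ∀ σ s t a d e → (σ * a) * (s * d + t * e) ≡ s * ((σ * a) * d) + t * ((σ * a) * e)
  minor-linear = solve-∀

  term-linear : ∀ j → term C j ≡ s * term A j + t * term B j
  term-linear j with j Fin.≟ c
  ... | yes refl = begin
    (sgn (toℕ j) * C zero j) * detℤ (minor C j)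
      ≡⟨ cong (λ e → (sgn (toℕ j) * e) * detℤ (minor C j)) (Cc zero) ⟩
    (sgn (toℕ j) * (s * A zero j + t * B zero j)) * detℤ (minor C j)
      ≡⟨ entry-linear (sgn (toℕ j)) s t (A zero j) (B zero j) _ ⟩
    s * ((sgn (toℕ j) * A zero j) * detℤ (minor C j)) + t * ((sgn (toℕ j) * B zero j) * detℤ (minor C j))
      ≡⟨ cong₂ (λ d e → s * ((sgn (toℕ j) * A zero j) * d) + t * ((sgn (toℕ j) * B zero j) * e))
           (detℤ-cong λ r k → ≡.sym (A≗C (suc r) (punchIn j k) (Fin.punchInᵢ≢i j k)))
           (detℤ-cong λ r k → ≡.sym (B≗C (suc r) (punchIn j k) (Fin.punchInᵢ≢i j k))) ⟩
    s * term A j + t * term B j ∎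
  ... | no j≢c = begin
    (sgn (toℕ j) * C zero j) * detℤ (minor C j)
      ≡⟨ cong ((sgn (toℕ j) * C zero j) *_)
           (detℤ-linear (punchOut j≢c) s t
             (λ r k k≢ → A≗C (suc r) (punchIn j k) (off k≢))
             (λ r k k≢ → B≗C (suc r) (punchIn j k) (off k≢))
             (λ r → subst (λ l → C (suc r) l ≡ s * A (suc r) l + t * B (suc r) l)
                      (≡.sym (Fin.punchIn-punchOut j≢c)) (Cc (suc r)))) ⟩
    (sgn (toℕ j) * C zero j) * (s * detℤ (minor A j) + t * detℤ (minor B j))
      ≡⟨ minor-linear (sgn (toℕ j)) s t (C zero j) _ _ ⟩
    s * ((sgn (toℕ j) * C zero j) * detℤ (minor A j)) + t * ((sgn (toℕ j) * C zero j) * detℤ (minor B j))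
      ≡⟨ cong₂ (λ a b → s * ((sgn (toℕ j) * a) * detℤ (minor A j)) + t * ((sgn (toℕ j) * b) * detℤ (minor B j)))
           (≡.sym (A≗C zero j j≢c)) (≡.sym (B≗C zero j j≢c)) ⟩
    s * term A j + t * term B j ∎
    where
    off : ∀ {k} → k ≢ punchOut j≢c → punchIn j k ≢ c
    off k≢ eq = k≢ (Fin.punchIn-injective j _ _ (trans eq (≡.sym (Fin.punchIn-punchOut j≢c))))

-- Antisymmetry in the columns

swapAdj : ∀ {m} → Fin m → Fin (suc m) → Fin (suc m)
swapAdj zero    zero          = suc zero
swapAdj zero    (suc zero)    = zero
swapAdj zero    (suc (suc k)) = suc (suc k)
swapAdj (suc c) zero          = zero
swapAdj (suc c) (suc k)       = suc (swapAdj c k)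

-- The left case is that j is one of the two exchanged positions.
swapAdj-punchIn : ∀ {m} (c : Fin (suc m)) (j : Fin (suc (suc m))) →
  (sgn (toℕ j) ≡ - sgn (toℕ (swapAdj c j)) × (∀ k → swapAdj c (punchIn j k) ≡ punchIn (swapAdj c j) k))
  ⊎ (swapAdj c j ≡ j × ∃ λ c′ → ∀ k → swapAdj c (punchIn j k) ≡ punchIn j (swapAdj c′ k))
swapAdj-punchIn zero zero = inj₁ (refl , λ { zero → refl ; (suc k) → refl })
swapAdj-punchIn zero (suc zero) = inj₁ (refl , λ { zero → refl ; (suc k) → refl })
swapAdj-punchIn {suc m} zero (suc (suc j)) =
  inj₂ (refl , zero , λ { zero → refl ; (suc zero) → refl ; (suc (suc k)) → refl })
swapAdj-punchIn {suc m} (suc c) zero = inj₂ (refl , c , λ k → refl)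
swapAdj-punchIn {suc m} (suc c) (suc j) with swapAdj-punchIn c j
... | inj₁ (eq , f) = inj₁ (cong -_ eq , λ { zero → refl ; (suc k) → cong suc (f k) })
... | inj₂ (eq , c′ , f) = inj₂ (cong suc eq , suc c′ , λ { zero → refl ; (suc k) → cong suc (f k) })

sum-swapAdj : ∀ {m} (c : Fin m) (t : Fin (suc m) → ℤ) → sum (t ∘ swapAdj c) ≡ sum t
sum-swapAdj zero    t = exchange (t (suc zero)) (t zero) (sum λ k → t (suc (suc k)))
  where
  exchange : ∀ a b s → a + (b + s) ≡ b + (a + s)
  exchange = solve-∀
sum-swapAdj (suc c) t = cong (λ s → t zero + s) (sum-swapAdj c (t ∘ suc))

-- The terms of the two exchanged columns trade places, and their position signs differ; every other
-- term keeps its place and changes sign through its minor.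
detℤ-swapAdj : ∀ {m} (c : Fin m) (A : Matrix (suc m)) →
  detℤ (λ i j → A i (swapAdj c j)) ≡ - detℤ A
detℤ-swapAdj {suc m} c A = begin
  sum (λ j → (sgn (toℕ j) * A zero (swapAdj c j)) * detℤ (minor A′ j))
    ≡⟨ sum-cong-≋ term-swap ⟩
  sum (λ j → - 1ℤ * term (swapAdj c j))
    ≡⟨ sum-swapAdj c (λ j → - 1ℤ * term j) ⟩
  sum (λ j → - 1ℤ * term j)
    ≡⟨ ≡.sym (*-distribˡ-sum (- 1ℤ) term) ⟩
  - 1ℤ * sum term
    ≡⟨ ℤ.-1*i≡-i (sum term) ⟩
  - sum term ∎
  where
  A′ : Matrix (suc (suc m))
  A′ i j = A i (swapAdj c j)

  term : Fin (suc (suc m)) → ℤ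
  term j = (sgn (toℕ j) * A zero j) * detℤ (minor A j)

  sign-out : ∀ σ a d → (- σ * a) * d ≡ - 1ℤ * ((σ * a) * d)
  sign-out = solve-∀

  sign-out′ : ∀ σ a d → (σ * a) * - d ≡ - 1ℤ * ((σ * a) * d)
  sign-out′ = solve-∀

  term-swap : ∀ j → (sgn (toℕ j) * A zero (swapAdj c j)) * detℤ (minor A′ j) ≡ - 1ℤ * term (swapAdj c j)
  term-swap j with swapAdj-punchIn c j
  ... | inj₁ (eq , f) = trans
    (cong₂ (λ σ d → (σ * A zero (swapAdj c j)) * d) eq (detℤ-cong λ r k → cong (A (suc r)) (f k)))
    (sign-out (sgn (toℕ (swapAdj c j))) (A zero (swapAdj c j)) _)
  ... | inj₂ (eq , c′ , f) rewrite eq = trans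
    (cong ((sgn (toℕ j) * A zero j) *_)
      (trans (detℤ-cong λ r k → cong (A (suc r)) (f k)) (detℤ-swapAdj c′ (minor A j))))
    (sign-out′ (sgn (toℕ j)) (A zero j) _)

[_∣_] : ∀ {m} → (Fin (suc m) → ℤ) → (Fin (suc m) → Fin m → ℤ) → Matrix (suc m)
[ v ∣ C ] i zero    = v i
[ v ∣ C ] i (suc j) = C i j

i≡-i⇒i≡0 : ∀ {i} → i ≡ - i → i ≡ 0ℤ
i≡-i⇒i≡0 {+ zero} eq = refl

-- When the equal columns are adjacent, exchanging them gives `d ≡ - d`; a copy further right is
-- moved towards column 0 by adjacent exchanges.
detℤ-repeated-column : ∀ {m} (j : Fin m) (C : Fin (suc m) → Fin m → ℤ) →
  detℤ [ (λ i → C i j) ∣ C ] ≡ 0ℤ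
detℤ-repeated-column {suc m} = <-weakInduction P base step
  where
  P : Fin (suc m) → Set
  P j = ∀ C → detℤ [ (λ i → C i j) ∣ C ] ≡ 0ℤ

  base : P zero
  base C = i≡-i⇒i≡0 (trans
    (detℤ-cong {A = [ (λ i → C i zero) ∣ C ]} {B = λ i j → [ (λ i → C i zero) ∣ C ] i (swapAdj zero j)}
      λ { i zero → refl ; i (suc zero) → refl ; i (suc (suc k)) → refl })
    (detℤ-swapAdj zero [ (λ i → C i zero) ∣ C ]))

  swapAdj-inject₁ : ∀ {m} (j : Fin m) → swapAdj j (inject₁ j) ≡ suc j
  swapAdj-inject₁ zero    = refl
  swapAdj-inject₁ (suc j) = cong suc (swapAdj-inject₁ j)

  step : ∀ j → P (inject₁ j) → P (suc j)
  -- Exchanging columns `inject₁ j` and `suc j` of `C` moves the copy one place left at the cost of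
  -- a sign, and `- 0ℤ` computes to `0ℤ`.
  step j ih C = ℤ.neg-injective (trans (≡.sym (detℤ-swapAdj (suc j) [ (λ i → C i (suc j)) ∣ C ])) (trans
    (detℤ-cong {A = λ i k → [ (λ i → C i (suc j)) ∣ C ] i (swapAdj (suc j) k)}
               {B = [ (λ i → C i (swapAdj j (inject₁ j))) ∣ (λ i k → C i (swapAdj j k)) ]}
      λ { i zero → cong (C i) (≡.sym (swapAdj-inject₁ j)) ; i (suc k) → refl })
    (ih λ i k → C i (swapAdj j k))))

-- Column operations

detℤ-first-column-linear : ∀ {m} (s t : ℤ) {u v w : Fin (suc m) → ℤ} (C : Fin (suc m) → Fin m → ℤ) →
  (∀ i → w i ≡ s * u i + t * v i) →
  detℤ [ w ∣ C ] ≡ s * detℤ [ u ∣ C ] + t * detℤ [ v ∣ C ]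
detℤ-first-column-linear s t C eq = detℤ-linear zero s t off off eq
  where
  off : ∀ {u w} i j → j ≢ zero → [ u ∣ C ] i j ≡ [ w ∣ C ] i j
  off i zero    j≢0 = contradiction refl j≢0
  off i (suc j) _   = refl

detℤ-first-column-zero : ∀ {m} {v : Fin (suc m) → ℤ} (C : Fin (suc m) → Fin m → ℤ) →
  (∀ i → v i ≡ 0ℤ) → detℤ [ v ∣ C ] ≡ 0ℤ
-- A zero column is `0 v + 0 v`, and the resulting combination of determinants computes to `0ℤ`.
detℤ-first-column-zero {v = v} C v≡0 = detℤ-first-column-linear 0ℤ 0ℤ {v} {v} C v≡0

detℤ-first-column-sum : ∀ {m} k (g : Fin k → ℤ) (vs : Fin k → Fin (suc m) → ℤ) (C : Fin (suc m) → Fin m → ℤ) →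
  detℤ [ (λ i → sum λ l → g l * vs l i) ∣ C ] ≡ sum λ l → g l * detℤ [ vs l ∣ C ]
detℤ-first-column-sum zero    g vs C = detℤ-first-column-zero C (λ i → refl)
detℤ-first-column-sum (suc k) g vs C = begin
  detℤ [ (λ i → sum λ l → g l * vs l i) ∣ C ]
    ≡⟨ detℤ-first-column-linear (g zero) 1ℤ {vs zero} {λ i → sum λ l → g (suc l) * vs (suc l) i} C
         (λ i → cong (λ s → g zero * vs zero i + s) (≡.sym (ℤ.*-identityˡ _))) ⟩
  g zero * detℤ [ vs zero ∣ C ] + 1ℤ * detℤ [ (λ i → sum λ l → g (suc l) * vs (suc l) i) ∣ C ]
    ≡⟨ cong (λ s → g zero * detℤ [ vs zero ∣ C ] + s)
         (trans (ℤ.*-identityˡ _) (detℤ-first-column-sum k (g ∘ suc) (vs ∘ suc) C)) ⟩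
  sum (λ l → g l * detℤ [ vs l ∣ C ]) ∎

sum-zero : ∀ {k} (t : Fin k → ℤ) → (∀ l → t l ≡ 0ℤ) → sum t ≡ 0ℤ
sum-zero {zero}  t t≡0 = refl
sum-zero {suc k} t t≡0 = cong₂ _+_ (t≡0 zero) (sum-zero (t ∘ suc) (t≡0 ∘ suc))

-- The added multiples contribute only determinants with a repeated column. Later `s` is T and `g`
-- is T times the solution w, which clears the first column below its top entry without division.
detℤ-combine-into-first : ∀ {m} (s : ℤ) (g : Fin m → ℤ) (v : Fin (suc m) → ℤ) (C : Fin (suc m) → Fin m → ℤ) →
  detℤ [ (λ i → s * v i + sum λ j → g j * C i j) ∣ C ] ≡ s * detℤ [ v ∣ C ]
detℤ-combine-into-first s g v C = begin
  detℤ [ (λ i → s * v i + sum λ j → g j * C i j) ∣ C ]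
    ≡⟨ detℤ-first-column-linear s 1ℤ {v} {λ i → sum λ j → g j * C i j} C
         (λ i → cong (λ e → s * v i + e) (≡.sym (ℤ.*-identityˡ _))) ⟩
  s * detℤ [ v ∣ C ] + 1ℤ * detℤ [ (λ i → sum λ j → g j * C i j) ∣ C ]
    ≡⟨ cong (λ e → s * detℤ [ v ∣ C ] + 1ℤ * e)
         (trans (detℤ-first-column-sum _ g (λ j i → C i j) C)
           (sum-zero _ λ j → trans (cong (g j *_) (detℤ-repeated-column j C)) (ℤ.*-zeroʳ (g j)))) ⟩
  s * detℤ [ v ∣ C ] + 0ℤ
    ≡⟨ ℤ.+-identityʳ _ ⟩
  s * detℤ [ v ∣ C ] ∎

detℤ-first-row : ∀ {m} (M : Matrix (suc m)) → (∀ j → M zero (suc j) ≡ 0ℤ) →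
  detℤ M ≡ M zero zero * detℤ (λ r c → M (suc r) (suc c))
detℤ-first-row M row≡0 = trans
  (cong₂ _+_
    (cong (_* detℤ (minor M zero)) (ℤ.*-identityˡ (M zero zero)))
    (sum-zero _ λ j → trans
      (cong (_* detℤ (minor M (suc j))) (trans (cong (sgn (toℕ (suc j)) *_) (row≡0 j)) (ℤ.*-zeroʳ (sgn (toℕ (suc j))))))
      (ℤ.*-zeroˡ (detℤ (minor M (suc j))))))
  (ℤ.+-identityʳ _)

-- The expansion stays along row 0: for `j` past the first, the minor keeps the zero part of column
-- 0 as its own first column.
detℤ-first-column : ∀ {m} (M : Matrix (suc m)) → (∀ i → M (suc i) zero ≡ 0ℤ) →
  detℤ M ≡ M zero zero * detℤ (λ r c → M (suc r) (suc c))
detℤ-first-column {zero}  M col≡0 = detℤ-first-row M λ ()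
detℤ-first-column {suc m} M col≡0 = trans
  (cong₂ _+_
    (cong (_* detℤ (minor M zero)) (ℤ.*-identityˡ (M zero zero)))
    (sum-zero _ λ j → trans
      (cong ((sgn (toℕ (suc j)) * M zero (suc j)) *_) (trans
        (detℤ-cong {A = minor M (suc j)} {B = [ (λ r → M (suc r) zero) ∣ (λ r c → minor M (suc j) r (suc c)) ]}
          λ { r zero → refl ; r (suc c) → refl })
        (detℤ-first-column-zero (λ r c → minor M (suc j) r (suc c)) col≡0)))
      (ℤ.*-zeroʳ (sgn (toℕ (suc j)) * M zero (suc j)))))
  (ℤ.+-identityʳ _)

-- One column is treated at a time: in `go k` the multiplier `f` vanishes from position `k` on.
-- Linearity in the last possibly nonzero column `j₀` leaves the matrix with `f j₀` reset to 0 and a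
-- multiple of one whose column `j₀` is a copy of `v`.
detℤ-add-first-to-others : ∀ {m} (f : Fin m → ℤ) (v : Fin (suc m) → ℤ) (C : Fin (suc m) → Fin m → ℤ) →
  detℤ [ v ∣ (λ i j → C i j + f j * v i) ] ≡ detℤ [ v ∣ C ]
detℤ-add-first-to-others {m} f v C = go m f λ j m≤j → contradiction (Fin.toℕ<n j) (ℕ.≤⇒≯ m≤j)
  where
  added : (Fin m → ℤ) → Matrix (suc m)
  added f = [ v ∣ (λ i j → C i j + f j * v i) ]

  go : ∀ k f → (∀ j → k ≤ toℕ j → f j ≡ 0ℤ) → detℤ (added f) ≡ detℤ [ v ∣ C ]
  go zero f f≡0 = detℤ-cong {A = added f} {B = [ v ∣ C ]} λ where
    i zero    → refl
    i (suc j) → trans (cong (λ e → C i j + e * v i) (f≡0 j z≤n)) (ℤ.+-identityʳ (C i j))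
  go (suc k) f f≡0 with k ℕ.<? m
  ... | no k≮m = go k f λ j k≤j → contradiction (ℕ.≤-<-trans k≤j (Fin.toℕ<n j)) k≮m
  ... | yes k<m = begin
    detℤ (added f)
      ≡⟨ detℤ-linear (suc j₀) 1ℤ (f j₀) {added f′} {[ v ∣ D ]} {added f} off-f′ off-D at-j₀ ⟩
    1ℤ * detℤ (added f′) + f j₀ * detℤ [ v ∣ D ]
      ≡⟨ cong₂ (λ a b → 1ℤ * a + f j₀ * b) (go k f′ f′≡0) D≡0 ⟩
    1ℤ * detℤ [ v ∣ C ] + f j₀ * 0ℤ
      ≡⟨ simplify (detℤ [ v ∣ C ]) (f j₀) ⟩
    detℤ [ v ∣ C ] ∎
    where
    simplify : ∀ d e → 1ℤ * d + e * 0ℤ ≡ d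
    simplify = solve-∀

    j₀ : Fin m
    j₀ = Fin.fromℕ< k<m

    f′ : Fin m → ℤ
    f′ j = if ⌊ j Fin.≟ j₀ ⌋ then 0ℤ else f j

    D : Fin (suc m) → Fin m → ℤ
    D i j = if ⌊ j Fin.≟ j₀ ⌋ then v i else C i j + f j * v i

    D-at : ∀ i → D i j₀ ≡ v i
    D-at i with j₀ Fin.≟ j₀
    ... | yes _    = refl
    ... | no j₀≢j₀ = contradiction refl j₀≢j₀

    f′-at : f′ j₀ ≡ 0ℤ
    f′-at with j₀ Fin.≟ j₀
    ... | yes _    = refl
    ... | no j₀≢j₀ = contradiction refl j₀≢j₀

    D≡0 : detℤ [ v ∣ D ] ≡ 0ℤ
    D≡0 = trans
      (detℤ-cong {A = [ v ∣ D ]} {B = [ (λ i → D i j₀) ∣ D ]} λ { i zero → ≡.sym (D-at i) ; i (suc j) → refl })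
      (detℤ-repeated-column j₀ D)

    f′≡0 : ∀ j → k ≤ toℕ j → f′ j ≡ 0ℤ
    f′≡0 j k≤j with j Fin.≟ j₀
    ... | yes _   = refl
    ... | no j≢j₀ = f≡0 j (ℕ.≤∧≢⇒< k≤j λ k≡j → j≢j₀ (Fin.toℕ-injective (trans (≡.sym k≡j) (≡.sym (Fin.toℕ-fromℕ< k<m)))))

    off-f′ : ∀ i j → j ≢ suc j₀ → added f′ i j ≡ added f i j
    off-f′ i zero    _ = refl
    off-f′ i (suc j) j≢ with j Fin.≟ j₀
    ... | yes j≡j₀ = contradiction (cong suc j≡j₀) j≢
    ... | no _     = refl

    off-D : ∀ i j → j ≢ suc j₀ → [ v ∣ D ] i j ≡ added f i j
    off-D i zero    _ = refl
    off-D i (suc j) j≢ with j Fin.≟ j₀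
    ... | yes j≡j₀ = contradiction (cong suc j≡j₀) j≢
    ... | no _     = refl

    at-j₀ : ∀ i → C i j₀ + f j₀ * v i ≡ 1ℤ * (C i j₀ + f′ j₀ * v i) + f j₀ * D i j₀
    at-j₀ i = ≡.sym (trans (cong₂ (λ e d → 1ℤ * (C i j₀ + e * v i) + f j₀ * d) f′-at (D-at i)) (expand (C i j₀) (f j₀) (v i)))
      where
      expand : ∀ c f v → 1ℤ * (c + 0ℤ * v) + f * v ≡ c + f * v
      expand = solve-∀

-- Polynomials and their coefficients

eval : Poly → ℤ → ℤ
eval []      x = 0ℤ
eval (a ∷ p) x = a + x * eval p x

eval-+P : ∀ p q x → eval (p +P q) x ≡ eval p x + eval q x
eval-+P []      q       x = ≡.sym (ℤ.+-identityˡ _)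
eval-+P (a ∷ p) []      x = ≡.sym (ℤ.+-identityʳ _)
eval-+P (a ∷ p) (b ∷ q) x = trans (cong (λ e → (a + b) + x * e) (eval-+P p q x)) (regroup a b x (eval p x) (eval q x))
  where
  regroup : ∀ a b x p q → (a + b) + x * (p + q) ≡ (a + x * p) + (b + x * q)
  regroup = solve-∀

eval-scaleP : ∀ s p x → eval (scaleP s p) x ≡ s * eval p x
eval-scaleP s []      x = ≡.sym (ℤ.*-zeroʳ s)
eval-scaleP s (a ∷ p) x = trans (cong (λ e → s * a + x * e) (eval-scaleP s p x)) (factor s a x (eval p x))
  where
  factor : ∀ s a x p → s * a + x * (s * p) ≡ s * (a + x * p)
  factor = solve-∀

eval-*P : ∀ p q x → eval (p *P q) x ≡ eval p x * eval q x
eval-*P []      q x = refl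
eval-*P (a ∷ p) q x = begin
  eval (scaleP a q +P (+ 0 ∷ (p *P q))) x
    ≡⟨ eval-+P (scaleP a q) (+ 0 ∷ (p *P q)) x ⟩
  eval (scaleP a q) x + (0ℤ + x * eval (p *P q) x)
    ≡⟨ cong₂ (λ d e → d + (0ℤ + x * e)) (eval-scaleP a q x) (eval-*P p q x) ⟩
  a * eval q x + (0ℤ + x * (eval p x * eval q x))
    ≡⟨ factor a x (eval p x) (eval q x) ⟩
  (a + x * eval p x) * eval q x ∎
  where
  factor : ∀ a x p q → a * q + (0ℤ + x * (p * q)) ≡ (a + x * p) * q
  factor = solve-∀

coeff-+P : ∀ p q i → coeff (p +P q) i ≡ coeff p i + coeff q i
coeff-+P []      q       i       = ≡.sym (ℤ.+-identityˡ _)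
coeff-+P (a ∷ p) []      i       = ≡.sym (ℤ.+-identityʳ _)
coeff-+P (a ∷ p) (b ∷ q) zero    = refl
coeff-+P (a ∷ p) (b ∷ q) (suc i) = coeff-+P p q i

coeff-scaleP : ∀ s p i → coeff (scaleP s p) i ≡ s * coeff p i
coeff-scaleP s []      i       = ≡.sym (ℤ.*-zeroʳ s)
coeff-scaleP s (a ∷ p) zero    = refl
coeff-scaleP s (a ∷ p) (suc i) = coeff-scaleP s p i

coeff≡0⇒eval≡0 : ∀ p → (∀ i → coeff p i ≡ 0ℤ) → ∀ x → eval p x ≡ 0ℤ
coeff≡0⇒eval≡0 []      p≡0 x = refl
coeff≡0⇒eval≡0 (a ∷ p) p≡0 x = cong₂ _+_ (p≡0 0)
  (trans (cong (x *_) (coeff≡0⇒eval≡0 p (p≡0 ∘ suc) x)) (ℤ.*-zeroʳ x))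

-- A root of a + x q(x) beyond |a| forces a = 0, because x divides a.
eventually-zero⇒coeff≡0 : ∀ p B → (∀ k → B ≤ k → eval p (+ k) ≡ 0ℤ) → ∀ i → coeff p i ≡ 0ℤ
eventually-zero⇒coeff≡0 []      B p≡0 i = refl
eventually-zero⇒coeff≡0 (a ∷ p) B p≡0 = λ where
    zero    → a≡0
    (suc i) → eventually-zero⇒coeff≡0 p (suc B) tail≡0 i
  where
  k₀ : ℕ
  k₀ = B ℕ.+ suc ∣ a ∣

  at-k₀ : a ≡ - (+ k₀ * eval p (+ k₀))
  at-k₀ = trans (solve-for a _) (trans (cong (_+ - (+ k₀ * eval p (+ k₀))) (p≡0 k₀ (ℕ.m≤m+n B _))) (ℤ.+-identityˡ _))
    where
    solve-for : ∀ a b → a ≡ (a + b) + - b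
    solve-for = solve-∀

  multiple-small⇒zero : ∀ k b → ∣ a ∣ ≡ k ℕ.* b → ∣ a ∣ ℕ.< k → ∣ a ∣ ≡ 0
  multiple-small⇒zero k zero    eq lt = trans eq (ℕ.*-zeroʳ k)
  multiple-small⇒zero k (suc b) eq lt =
    contradiction lt (ℕ.≤⇒≯ (subst (k ≤_) (≡.sym eq) (ℕ.m≤m*n k (suc b))))

  a≡0 : a ≡ 0ℤ
  a≡0 = ℤ.∣i∣≡0⇒i≡0 (multiple-small⇒zero k₀ ∣ eval p (+ k₀) ∣
    (trans (cong ∣_∣ at-k₀) (trans (ℤ.∣-i∣≡∣i∣ (+ k₀ * eval p (+ k₀))) (ℤ.abs-* (+ k₀) (eval p (+ k₀)))))
    (ℕ.m≤n+m (suc ∣ a ∣) B))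

  -- Raising the bound to `suc B` makes `k` nonzero, so that it can be cancelled.
  tail≡0 : ∀ k → suc B ≤ k → eval p (+ k) ≡ 0ℤ
  tail≡0 (suc k) (s≤s B≤k) = ℤ.*-cancelˡ-≡ (+ suc k) (eval p (+ suc k)) 0ℤ (begin
    + suc k * eval p (+ suc k)     ≡⟨ ≡.sym (ℤ.+-identityˡ _) ⟩
    0ℤ + + suc k * eval p (+ suc k) ≡⟨ cong (_+ + suc k * eval p (+ suc k)) (≡.sym a≡0) ⟩
    a + + suc k * eval p (+ suc k) ≡⟨ p≡0 (suc k) (ℕ.m≤n⇒m≤1+n B≤k) ⟩
    0ℤ                             ≡⟨ ≡.sym (ℤ.*-zeroʳ (+ suc k)) ⟩
    + suc k * 0ℤ                   ∎)

_-P_ : Poly → Poly → Poly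
p -P q = p +P negP q

eval--P : ∀ p q x → eval (p -P q) x ≡ eval p x + - 1ℤ * eval q x
eval--P p q x = trans (eval-+P p (negP q) x) (cong (λ e → eval p x + e) (eval-scaleP (- + 1) q x))

coeff--P : ∀ p q i → coeff (p -P q) i ≡ coeff p i + - 1ℤ * coeff q i
coeff--P p q i = trans (coeff-+P p (negP q) i) (cong (λ e → coeff p i + e) (coeff-scaleP (- + 1) q i))

minus-self : ∀ {a b} → a ≡ b → a + - 1ℤ * b ≡ 0ℤ
minus-self {a} refl = lemma a
  where
  lemma : ∀ a → a + - 1ℤ * a ≡ 0ℤ
  lemma = solve-∀

minus≡0⇒≡ : ∀ a b → a + - 1ℤ * b ≡ 0ℤ → a ≡ b
minus≡0⇒≡ a b eq = trans (lemma a b) (trans (cong (_+ b) eq) (ℤ.+-identityˡ b))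
  where
  lemma : ∀ a b → a ≡ (a + - 1ℤ * b) + b
  lemma = solve-∀

coeff≡⇒eval≡ : ∀ p q → (∀ i → coeff p i ≡ coeff q i) → ∀ x → eval p x ≡ eval q x
coeff≡⇒eval≡ p q p≡q x = minus≡0⇒≡ _ _ (trans (≡.sym (eval--P p q x))
  (coeff≡0⇒eval≡0 (p -P q) (λ i → trans (coeff--P p q i) (minus-self (p≡q i))) x))

-- The free bound `B` allows polynomials to be compared only at points where the factor to be
-- cancelled is known to be nonzero.
eventually-≡⇒coeff≡ : ∀ p q B → (∀ k → B ≤ k → eval p (+ k) ≡ eval q (+ k)) → ∀ i → coeff p i ≡ coeff q i
eventually-≡⇒coeff≡ p q B p≡q i = minus≡0⇒≡ _ _ (trans (≡.sym (coeff--P p q i))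
  (eventually-zero⇒coeff≡0 (p -P q) B (λ k B≤k → trans (eval--P p q (+ k)) (minus-self (p≡q k B≤k))) i))

-- T R is ∏ (y + a) over a ∈ R, and U R is Σ a ∏ (y + b), with b ranging over
-- the other members of R.
T : List ℕ → Poly
T []      = 1ℤ ∷ []
T (a ∷ R) = scaleP (+ a) (T R) +P (0ℤ ∷ T R)

U : List ℕ → Poly
U []      = []
U (a ∷ R) = scaleP (+ a) (T R) +P (scaleP (+ a) (U R) +P (0ℤ ∷ U R))

eval-T-∷ : ∀ a R y → eval (T (a ∷ R)) y ≡ (y + + a) * eval (T R) y
eval-T-∷ a R y = begin
  eval (scaleP (+ a) (T R) +P (0ℤ ∷ T R)) y
    ≡⟨ eval-+P (scaleP (+ a) (T R)) (0ℤ ∷ T R) y ⟩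
  eval (scaleP (+ a) (T R)) y + (0ℤ + y * eval (T R) y)
    ≡⟨ cong (_+ (0ℤ + y * eval (T R) y)) (eval-scaleP (+ a) (T R) y) ⟩
  + a * eval (T R) y + (0ℤ + y * eval (T R) y)
    ≡⟨ factor (+ a) y (eval (T R) y) ⟩
  (y + + a) * eval (T R) y ∎
  where
  factor : ∀ a y t → a * t + (0ℤ + y * t) ≡ (y + a) * t
  factor = solve-∀

eval-U-∷ : ∀ a R y → eval (U (a ∷ R)) y ≡ + a * eval (T R) y + (y + + a) * eval (U R) y
eval-U-∷ a R y = begin
  eval (scaleP (+ a) (T R) +P (scaleP (+ a) (U R) +P (0ℤ ∷ U R))) y
    ≡⟨ eval-+P (scaleP (+ a) (T R)) _ y ⟩
  eval (scaleP (+ a) (T R)) y + eval (scaleP (+ a) (U R) +P (0ℤ ∷ U R)) y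
    ≡⟨ cong₂ _+_ (eval-scaleP (+ a) (T R) y) (eval-+P (scaleP (+ a) (U R)) (0ℤ ∷ U R) y) ⟩
  + a * eval (T R) y + (eval (scaleP (+ a) (U R)) y + (0ℤ + y * eval (U R) y))
    ≡⟨ cong (λ e → + a * eval (T R) y + (e + (0ℤ + y * eval (U R) y))) (eval-scaleP (+ a) (U R) y) ⟩
  + a * eval (T R) y + (+ a * eval (U R) y + (0ℤ + y * eval (U R) y))
    ≡⟨ factor (+ a) y (eval (T R) y) (eval (U R) y) ⟩
  + a * eval (T R) y + (y + + a) * eval (U R) y ∎
  where
  factor : ∀ a y t u → a * t + (a * u + (0ℤ + y * u)) ≡ a * t + (y + a) * u
  factor = solve-∀

-- At a positive integer every factor `y + a` is positive, and ℤ has no zero divisors.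
eval-T≢0 : ∀ R k → eval (T R) (+ suc k) ≢ 0ℤ
eval-T≢0 []      k eq with () ← trans (≡.sym (cong (λ e → 1ℤ + e) (ℤ.*-zeroʳ (+ suc k)))) eq
eval-T≢0 (a ∷ R) k eq with ℤ.i*j≡0⇒i≡0∨j≡0 (+ suc k + + a) (trans (≡.sym (eval-T-∷ a R (+ suc k))) eq)
... | inj₁ ()
... | inj₂ T≡0 = eval-T≢0 R k T≡0

-- Euler's relation U = N T − y T′, where N is the length of R.
coeff-U : ∀ R i → coeff (U R) i ≡ (+ length R + - + i) * coeff (T R) i
coeff-U []      zero    = refl
coeff-U []      (suc i) = ≡.sym (ℤ.*-zeroʳ (0ℤ + - + suc i))
coeff-U (a ∷ R) zero    = begin
  coeff (scaleP (+ a) (T R) +P (scaleP (+ a) (U R) +P (0ℤ ∷ U R))) 0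
    ≡⟨ trans (coeff-+P (scaleP (+ a) (T R)) _ 0) (cong₂ _+_ (coeff-scaleP (+ a) (T R) 0)
         (trans (coeff-+P (scaleP (+ a) (U R)) (0ℤ ∷ U R) 0) (cong (_+ 0ℤ) (coeff-scaleP (+ a) (U R) 0)))) ⟩
  + a * coeff (T R) 0 + (+ a * coeff (U R) 0 + 0ℤ)
    ≡⟨ cong (λ u → + a * coeff (T R) 0 + (+ a * u + 0ℤ)) (coeff-U R 0) ⟩
  + a * coeff (T R) 0 + (+ a * ((+ length R + 0ℤ) * coeff (T R) 0) + 0ℤ)
    ≡⟨ regroup (+ a) (+ length R) (coeff (T R) 0) ⟩
  ((1ℤ + + length R) + 0ℤ) * (+ a * coeff (T R) 0 + 0ℤ)
    ≡⟨ cong ((+ suc (length R) + 0ℤ) *_)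
         (≡.sym (trans (coeff-+P (scaleP (+ a) (T R)) (0ℤ ∷ T R) 0) (cong (_+ 0ℤ) (coeff-scaleP (+ a) (T R) 0)))) ⟩
  (+ suc (length R) + 0ℤ) * coeff (T (a ∷ R)) 0 ∎
  where
  regroup : ∀ a l t → a * t + (a * ((l + 0ℤ) * t) + 0ℤ) ≡ ((1ℤ + l) + 0ℤ) * (a * t + 0ℤ)
  regroup = solve-∀
coeff-U (a ∷ R) (suc i) = begin
  coeff (scaleP (+ a) (T R) +P (scaleP (+ a) (U R) +P (0ℤ ∷ U R))) (suc i)
    ≡⟨ trans (coeff-+P (scaleP (+ a) (T R)) _ (suc i)) (cong₂ _+_ (coeff-scaleP (+ a) (T R) (suc i))
         (trans (coeff-+P (scaleP (+ a) (U R)) (0ℤ ∷ U R) (suc i)) (cong (_+ coeff (U R) i) (coeff-scaleP (+ a) (U R) (suc i))))) ⟩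
  + a * t′ + (+ a * coeff (U R) (suc i) + coeff (U R) i)
    ≡⟨ cong₂ (λ u v → + a * t′ + (+ a * u + v)) (coeff-U R (suc i)) (coeff-U R i) ⟩
  + a * t′ + (+ a * ((+ length R + - + suc i) * t′) + (+ length R + - + i) * t)
    ≡⟨ cong (λ e → + a * t′ + (+ a * ((+ length R + e) * t′) + (+ length R + - + i) * t)) (ℤ.neg-distrib-+ 1ℤ (+ i)) ⟩
  + a * t′ + (+ a * ((+ length R + (- 1ℤ + - + i)) * t′) + (+ length R + - + i) * t)
    ≡⟨ regroup (+ a) (+ length R) (- + i) t t′ ⟩
  ((1ℤ + + length R) + (- 1ℤ + - + i)) * (+ a * t′ + t)
    ≡⟨ cong₂ (λ e c → (+ suc (length R) + e) * c) (≡.sym (ℤ.neg-distrib-+ 1ℤ (+ i)))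
         (≡.sym (trans (coeff-+P (scaleP (+ a) (T R)) (0ℤ ∷ T R) (suc i)) (cong (_+ t) (coeff-scaleP (+ a) (T R) (suc i))))) ⟩
  (+ suc (length R) + - + suc i) * coeff (T (a ∷ R)) (suc i) ∎
  where
  t t′ : ℤ
  t  = coeff (T R) i
  t′ = coeff (T R) (suc i)

  regroup : ∀ a l i t t′ → a * t′ + (a * ((l + (- 1ℤ + i)) * t′) + (l + i) * t) ≡ ((1ℤ + l) + (- 1ℤ + i)) * (a * t′ + t)
  regroup = solve-∀

coeff-T-beyond : ∀ R i → length R ℕ.< i → coeff (T R) i ≡ 0ℤ
coeff-T-beyond []      (suc i) _ = refl
coeff-T-beyond (a ∷ R) (suc i) (s≤s lt) = begin
  coeff (scaleP (+ a) (T R) +P (0ℤ ∷ T R)) (suc i)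
    ≡⟨ trans (coeff-+P (scaleP (+ a) (T R)) (0ℤ ∷ T R) (suc i)) (cong (_+ coeff (T R) i) (coeff-scaleP (+ a) (T R) (suc i))) ⟩
  + a * coeff (T R) (suc i) + coeff (T R) i
    ≡⟨ cong₂ (λ t′ t → + a * t′ + t) (coeff-T-beyond R (suc i) (ℕ.m≤n⇒m≤1+n lt)) (coeff-T-beyond R i lt) ⟩
  + a * 0ℤ + 0ℤ
    ≡⟨ cong (_+ 0ℤ) (ℤ.*-zeroʳ (+ a)) ⟩
  0ℤ ∎

-- Equals det (x I − D) in the variable y = x + 1.
χ : List ℕ → Poly
χ R = ((- 1ℤ ∷ 1ℤ ∷ []) *P T R) +P ((1ℤ ∷ - + 2 ∷ []) *P U R)

eval-χ : ∀ R y → eval (χ R) y ≡ (y + - 1ℤ) * eval (T R) y + (1ℤ + - + 2 * y) * eval (U R) y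
eval-χ R y = begin
  eval (((- 1ℤ ∷ 1ℤ ∷ []) *P T R) +P ((1ℤ ∷ - + 2 ∷ []) *P U R)) y
    ≡⟨ eval-+P ((- 1ℤ ∷ 1ℤ ∷ []) *P T R) ((1ℤ ∷ - + 2 ∷ []) *P U R) y ⟩
  eval ((- 1ℤ ∷ 1ℤ ∷ []) *P T R) y + eval ((1ℤ ∷ - + 2 ∷ []) *P U R) y
    ≡⟨ cong₂ _+_ (eval-*P (- 1ℤ ∷ 1ℤ ∷ []) (T R) y) (eval-*P (1ℤ ∷ - + 2 ∷ []) (U R) y) ⟩
  (- 1ℤ + y * (1ℤ + y * 0ℤ)) * eval (T R) y + (1ℤ + y * (- + 2 + y * 0ℤ)) * eval (U R) y
    ≡⟨ regroup y (eval (T R) y) (eval (U R) y) ⟩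
  (y + - 1ℤ) * eval (T R) y + (1ℤ + - + 2 * y) * eval (U R) y ∎
  where
  regroup : ∀ y t u → (- 1ℤ + y * (1ℤ + y * 0ℤ)) * t + (1ℤ + y * (- + 2 + y * 0ℤ)) * u ≡ (y + - 1ℤ) * t + (1ℤ + - + 2 * y) * u
  regroup = solve-∀

coeff-linear-*P : ∀ a b p i → coeff ((a ∷ b ∷ []) *P p) (suc i) ≡ a * coeff p (suc i) + b * coeff p i
coeff-linear-*P a b p i = trans
  (trans (coeff-+P (scaleP a p) _ (suc i)) (cong₂ _+_ (coeff-scaleP a p (suc i))
    (trans (coeff-+P (scaleP b p) (0ℤ ∷ []) i) (cong₂ _+_ (coeff-scaleP b p i) (coeff-0 i)))))
  (cong (λ e → a * coeff p (suc i) + e) (ℤ.+-identityʳ _))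
  where
  coeff-0 : ∀ i → coeff (0ℤ ∷ []) i ≡ 0ℤ
  coeff-0 zero    = refl
  coeff-0 (suc i) = refl

coeff-χ : ∀ R i → coeff (χ R) (suc i) ≡
  (1ℤ + - + 2 * (+ length R + - + i)) * coeff (T R) i + (+ length R + - + i + - + 2) * coeff (T R) (suc i)
coeff-χ R i = begin
  coeff (χ R) (suc i)
    ≡⟨ trans (coeff-+P ((- 1ℤ ∷ 1ℤ ∷ []) *P T R) _ (suc i))
         (cong₂ _+_ (coeff-linear-*P (- 1ℤ) 1ℤ (T R) i) (coeff-linear-*P 1ℤ (- + 2) (U R) i)) ⟩
  (- 1ℤ * t′ + 1ℤ * t) + (1ℤ * coeff (U R) (suc i) + - + 2 * coeff (U R) i)
    ≡⟨ cong₂ (λ u′ u → (- 1ℤ * t′ + 1ℤ * t) + (1ℤ * u′ + - + 2 * u))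
         (trans (coeff-U R (suc i)) (cong (λ e → (+ length R + e) * t′) (ℤ.neg-distrib-+ 1ℤ (+ i)))) (coeff-U R i) ⟩
  (- 1ℤ * t′ + 1ℤ * t) + (1ℤ * ((+ length R + (- 1ℤ + - + i)) * t′) + - + 2 * ((+ length R + - + i) * t))
    ≡⟨ regroup (+ length R) (- + i) t t′ ⟩
  (1ℤ + - + 2 * (+ length R + - + i)) * t + (+ length R + - + i + - + 2) * t′ ∎
  where
  t t′ : ℤ
  t  = coeff (T R) i
  t′ = coeff (T R) (suc i)

  regroup : ∀ l i t t′ → (- 1ℤ * t′ + 1ℤ * t) + (1ℤ * ((l + (- 1ℤ + i)) * t′) + - + 2 * ((l + i) * t))
    ≡ (1ℤ + - + 2 * (l + i)) * t + (l + i + - + 2) * t′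
  regroup = solve-∀

-- Recovering T and its roots

odd≢0 : ∀ z → 1ℤ + - + 2 * z ≢ 0ℤ
odd≢0 z eq = two-not-one ∣ z ∣ (trans (≡.sym (ℤ.abs-* (+ 2) z)) (cong ∣_∣ (≡.sym one≡2z)))
  where
  add : ∀ z → 1ℤ ≡ (1ℤ + - + 2 * z) + + 2 * z
  add = solve-∀

  one≡2z : 1ℤ ≡ + 2 * z
  one≡2z = trans (add z) (trans (cong (_+ + 2 * z) eq) (ℤ.+-identityˡ _))

  two-not-one : ∀ n → 2 ℕ.* n ≢ 1
  two-not-one (suc n) eq with () ← trans (≡.sym (ℕ.+-suc n (n ℕ.+ 0))) (ℕ.suc-injective eq)

-- Equal lengths give both recursions the same factors. The descent starts beyond the degree, where
-- both coefficients vanish; `d` bounds the distance from `i` to that range.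
χ-determines-T : ∀ R S → length R ≡ length S → (∀ i → coeff (χ R) i ≡ coeff (χ S) i) →
  ∀ i → coeff (T R) i ≡ coeff (T S) i
χ-determines-T R S len χ≡ i = go (suc (length R)) i (ℕ.m≤n+m (suc (length R)) i)
  where
  go : ∀ d i → suc (length R) ≤ i ℕ.+ d → coeff (T R) i ≡ coeff (T S) i
  go zero    i le = trans (coeff-T-beyond R i le′) (≡.sym (coeff-T-beyond S i (subst (ℕ._< i) len le′)))
    where
    le′ : length R ℕ.< i
    le′ = subst (suc (length R) ≤_) (ℕ.+-identityʳ i) le
  go (suc d) i le = ℤ.*-cancelˡ-≡ odd _ _ {{≢-nonZero (odd≢0 (+ length R + - + i))}}
    (+-cancelʳ (next * coeff (T R) (suc i)) _ _ (begin
      odd * coeff (T R) i + next * coeff (T R) (suc i)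
        ≡⟨ ≡.sym (coeff-χ R i) ⟩
      coeff (χ R) (suc i)
        ≡⟨ χ≡ (suc i) ⟩
      coeff (χ S) (suc i)
        ≡⟨ coeff-χ S i ⟩
      (1ℤ + - + 2 * (+ length S + - + i)) * coeff (T S) i + (+ length S + - + i + - + 2) * coeff (T S) (suc i)
        ≡⟨ cong₂ (λ l t → (1ℤ + - + 2 * (+ l + - + i)) * coeff (T S) i + (+ l + - + i + - + 2) * t)
             (≡.sym len) (≡.sym (go d (suc i) (subst (suc (length R) ≤_) (ℕ.+-suc i d) le))) ⟩
      odd * coeff (T S) i + next * coeff (T R) (suc i) ∎))
    where
    odd next : ℤ
    odd  = 1ℤ + - + 2 * (+ length R + - + i)
    next = + length R + - + i + - + 2

-- T splits into linear factors over an integral domain, so a root is the root of one of them.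
eval-T-root : ∀ R a → eval (T R) (- + a) ≡ 0ℤ → a ∈ R
eval-T-root []      a eq with () ← trans (≡.sym (cong (λ e → 1ℤ + e) (ℤ.*-zeroʳ (- + a)))) eq
eval-T-root (b ∷ R) a eq with ℤ.i*j≡0⇒i≡0∨j≡0 (- + a + + b) (trans (≡.sym (eval-T-∷ b R (- + a))) eq)
... | inj₁ -a+b≡0 = here (ℤ.+-injective (trans (add (+ a) (+ b)) (trans (cong (λ e → + b + - 1ℤ * e) -a+b≡0) (ℤ.+-identityʳ (+ b)))))
  where
  add : ∀ a b → a ≡ b + - 1ℤ * (- a + b)
  add = solve-∀
... | inj₂ T≡0 = there (eval-T-root R a T≡0)

eval-T-↭ : ∀ {R S} → R ↭ S → ∀ y → eval (T R) y ≡ eval (T S) y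
eval-T-↭ Perm.refl y = refl
eval-T-↭ (Perm.prep {R} {S} a p) y =
  trans (eval-T-∷ a R y) (trans (cong ((y + + a) *_) (eval-T-↭ p y)) (≡.sym (eval-T-∷ a S y)))
eval-T-↭ (Perm.swap {R} {S} a b p) y = begin
  eval (T (a ∷ b ∷ R)) y
    ≡⟨ trans (eval-T-∷ a (b ∷ R) y) (cong ((y + + a) *_) (eval-T-∷ b R y)) ⟩
  (y + + a) * ((y + + b) * eval (T R) y)
    ≡⟨ cong (λ t → (y + + a) * ((y + + b) * t)) (eval-T-↭ p y) ⟩
  (y + + a) * ((y + + b) * eval (T S) y)
    ≡⟨ exchange (y + + a) (y + + b) (eval (T S) y) ⟩
  (y + + b) * ((y + + a) * eval (T S) y)
    ≡⟨ ≡.sym (trans (eval-T-∷ b (a ∷ S) y) (cong ((y + + b) *_) (eval-T-∷ a S y))) ⟩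
  eval (T (b ∷ a ∷ S)) y ∎
  where
  exchange : ∀ a b t → a * (b * t) ≡ b * (a * t)
  exchange = solve-∀
eval-T-↭ (Perm.trans p q) y = trans (eval-T-↭ p y) (eval-T-↭ q y)

-- Unique factorisation by peeling: `- a` is a root of `T S`, so `a` occurs in `S`; it is moved to
-- the front and the common factor `y + a` is cancelled pointwise.
T-determines-roots : ∀ R S → (∀ i → coeff (T R) i ≡ coeff (T S) i) → R ↭ S
T-determines-roots []      []      T≡ = ↭-refl
T-determines-roots []      (b ∷ S) T≡ with () ← eval-T-root [] b (trans (coeff≡⇒eval≡ (T []) (T (b ∷ S)) T≡ (- + b))
  (trans (eval-T-∷ b S (- + b)) (cong (_* eval (T S) (- + b)) (ℤ.+-inverseˡ (+ b)))))
T-determines-roots (a ∷ R) S       T≡ with ∈-∃++ (eval-T-root S a (trans (≡.sym (coeff≡⇒eval≡ (T (a ∷ R)) (T S) T≡ (- + a)))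
  (trans (eval-T-∷ a R (- + a)) (cong (_* eval (T R) (- + a)) (ℤ.+-inverseˡ (+ a))))))
... | S₁ , S₂ , refl = ↭-trans (Perm.prep a (T-determines-roots R (S₁ ++ S₂) T≡′)) (↭-sym (shift a S₁ S₂))
  where
  T≡′ : ∀ i → coeff (T R) i ≡ coeff (T (S₁ ++ S₂)) i
  -- From the bound 1 on, `y + a` is positive even when `a` is a padding zero.
  T≡′ = eventually-≡⇒coeff≡ (T R) (T (S₁ ++ S₂)) 1 λ where
    (suc k) _ → ℤ.*-cancelˡ-≡ (+ suc k + + a) _ _ (begin
      (+ suc k + + a) * eval (T R) (+ suc k)
        ≡⟨ ≡.sym (eval-T-∷ a R (+ suc k)) ⟩
      eval (T (a ∷ R)) (+ suc k)
        ≡⟨ coeff≡⇒eval≡ (T (a ∷ R)) (T S) T≡ (+ suc k) ⟩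
      eval (T (S₁ ++ a ∷ S₂)) (+ suc k)
        ≡⟨ eval-T-↭ (shift a S₁ S₂) (+ suc k) ⟩
      eval (T (a ∷ S₁ ++ S₂)) (+ suc k)
        ≡⟨ eval-T-∷ a (S₁ ++ S₂) (+ suc k) ⟩
      (+ suc k + + a) * eval (T (S₁ ++ S₂)) (+ suc k) ∎)

-- The block matrix

⟦_⟧ : Bool → ℤ
⟦ b ⟧ = if b then 1ℤ else 0ℤ

_≈[_]_ : ℕ → List ℕ → ℕ → Bool
i ≈[ ps ] j = blockOf ps i ≡ᵇ blockOf ps j

-- With entries given on ℕ, deleting row and column 0 turns `blockMatrix (suc m ∷ ps)` into
-- `blockMatrix (m ∷ ps)` by computation alone.
onFin : ∀ {N} → (ℕ → ℕ → ℤ) → Matrix N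
onFin f i j = f (toℕ i) (toℕ j)

blockMatrix : List ℕ → ℤ → ℕ → ℕ → ℤ
blockMatrix ps y i j = y * ⟦ i ≡ᵇ j ⟧ + ⟦ i ≈[ ps ] j ⟧

y*0+0 : ∀ y → y * 0ℤ + 0ℤ ≡ 0ℤ
y*0+0 = solve-∀

-- The block matrix of m ∷ ps with the diagonal block of m replaced by y I.
clearedMatrix : ℕ → List ℕ → ℤ → ℕ → ℕ → ℤ
clearedMatrix m ps y i j = y * ⟦ i ≡ᵇ j ⟧ + ⟦ not (i <ᵇ m) ∧ (i ≈[ m ∷ ps ] j) ⟧

-- Each of the first `m` rows has only its diagonal entry `y`; expanding along them leaves the
-- matrix of the other blocks.
detℤ-cleared : ∀ m ps N y → detℤ (onFin {m ℕ.+ N} (clearedMatrix m ps y)) ≡ y ^ m * detℤ (onFin {N} (blockMatrix ps y))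
detℤ-cleared zero    ps N y = ≡.sym (ℤ.*-identityˡ _)
detℤ-cleared (suc m) ps N y = begin
  detℤ (onFin {suc m ℕ.+ N} (clearedMatrix (suc m) ps y))
    ≡⟨ detℤ-first-row (onFin {suc m ℕ.+ N} (clearedMatrix (suc m) ps y)) (λ j → y*0+0 y) ⟩
  (y * 1ℤ + 0ℤ) * detℤ (onFin {m ℕ.+ N} (clearedMatrix m ps y))
    ≡⟨ cong ((y * 1ℤ + 0ℤ) *_) (detℤ-cleared m ps N y) ⟩
  (y * 1ℤ + 0ℤ) * (y ^ m * detℤ (onFin {N} (blockMatrix ps y)))
    ≡⟨ reassoc y (y ^ m) (detℤ (onFin {N} (blockMatrix ps y))) ⟩
  (y * y ^ m) * detℤ (onFin {N} (blockMatrix ps y)) ∎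
  where
  reassoc : ∀ y z d → (y * 1ℤ + 0ℤ) * (z * d) ≡ (y * z) * d
  reassoc = solve-∀

-- The first column is `y e₀ + b`, where `b` is the indicator of the first block. The `e₀` part
-- shrinks that block by one. In the `b` part, subtracting `b` from the other columns of the block
-- cancels its ones and leaves `y` on their diagonal.
detℤ-block-step : ∀ m ps N y →
  detℤ (onFin {suc m ℕ.+ N} (blockMatrix (suc m ∷ ps) y))
  ≡ y * detℤ (onFin {m ℕ.+ N} (blockMatrix (m ∷ ps) y)) + y ^ m * detℤ (onFin {N} (blockMatrix ps y))
detℤ-block-step m ps N y = begin
  detℤ (onFin {suc m ℕ.+ N} (blockMatrix (suc m ∷ ps) y))
    ≡⟨ detℤ-cong {A = onFin (blockMatrix (suc m ∷ ps) y)} {B = [ (λ i → onFin (blockMatrix (suc m ∷ ps) y) i zero) ∣ C ]}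
         (λ { i zero → refl ; i (suc j) → refl }) ⟩
  detℤ [ (λ i → onFin (blockMatrix (suc m ∷ ps) y) i zero) ∣ C ]
    ≡⟨ detℤ-first-column-linear y 1ℤ {e₀} {b} C (λ i → cong (λ e → y * e₀ i + e) (≡.sym (ℤ.*-identityˡ (b i)))) ⟩
  y * detℤ [ e₀ ∣ C ] + 1ℤ * detℤ [ b ∣ C ]
    ≡⟨ cong₂ (λ d e → y * d + 1ℤ * e) (trans (detℤ-first-column [ e₀ ∣ C ] (λ i → refl)) (ℤ.*-identityˡ _)) det-b ⟩
  y * detℤ (onFin {m ℕ.+ N} (blockMatrix (m ∷ ps) y)) + 1ℤ * (y ^ m * detℤ (onFin {N} (blockMatrix ps y)))
    ≡⟨ cong (λ e → y * detℤ (onFin {m ℕ.+ N} (blockMatrix (m ∷ ps) y)) + e) (ℤ.*-identityˡ _) ⟩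
  y * detℤ (onFin {m ℕ.+ N} (blockMatrix (m ∷ ps) y)) + y ^ m * detℤ (onFin {N} (blockMatrix ps y)) ∎
  where
  C C′ : Fin (suc (m ℕ.+ N)) → Fin (m ℕ.+ N) → ℤ
  C  i j = blockMatrix (suc m ∷ ps) y (toℕ i) (suc (toℕ j))
  C′ i j = clearedMatrix (suc m) ps y (toℕ i) (suc (toℕ j))

  e₀ b : Fin (suc (m ℕ.+ N)) → ℤ
  e₀ i = ⟦ toℕ i ≡ᵇ 0 ⟧
  b  i = ⟦ toℕ i ≈[ suc m ∷ ps ] 0 ⟧

  f : Fin (m ℕ.+ N) → ℤ
  f j = - ⟦ suc (toℕ j) ≈[ suc m ∷ ps ] 0 ⟧

  clear : ∀ i j → clearedMatrix (suc m) ps y i (suc j)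
    ≡ blockMatrix (suc m ∷ ps) y i (suc j) + - ⟦ suc j ≈[ suc m ∷ ps ] 0 ⟧ * ⟦ i ≈[ suc m ∷ ps ] 0 ⟧
  clear i j with i <ᵇ suc m | j <ᵇ m
  ... | true  | true  = both y ⟦ i ≡ᵇ suc j ⟧
    where
    both : ∀ y e → y * e + 0ℤ ≡ (y * e + 1ℤ) + - 1ℤ * 1ℤ
    both = solve-∀
  ... | true  | false = ≡.sym (ℤ.+-identityʳ _)
  ... | false | true  = ≡.sym (ℤ.+-identityʳ _)
  ... | false | false = ≡.sym (ℤ.+-identityʳ _)

  det-b : detℤ [ b ∣ C ] ≡ y ^ m * detℤ (onFin {N} (blockMatrix ps y))
  det-b = begin
    detℤ [ b ∣ C ]
      ≡⟨ ≡.sym (detℤ-add-first-to-others f b C) ⟩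
    detℤ [ b ∣ (λ i j → C i j + f j * b i) ]
      ≡⟨ detℤ-cong {A = [ b ∣ (λ i j → C i j + f j * b i) ]} {B = [ b ∣ C′ ]}
           (λ { i zero → refl ; i (suc j) → ≡.sym (clear (toℕ i) (toℕ j)) }) ⟩
    detℤ [ b ∣ C′ ]
      ≡⟨ detℤ-first-row [ b ∣ C′ ] (λ j → y*0+0 y) ⟩
    1ℤ * detℤ (onFin {m ℕ.+ N} (clearedMatrix m ps y))
      ≡⟨ trans (ℤ.*-identityˡ _) (detℤ-cleared m ps N y) ⟩
    y ^ m * detℤ (onFin {N} (blockMatrix ps y)) ∎

-- Zeros fill up the blocks so that the list has one entry per vertex other
-- than v; then T (padded ps) is y^(n−1−k) ∏ (y + n_i).
pad : ℕ → List ℕ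
pad zero    = []
pad (suc m) = suc m ∷ replicate m 0

padded : List ℕ → List ℕ
padded []       = []
padded (m ∷ ps) = pad m ++ padded ps

-- The determinant of `y I + J_m`; the case split gives the empty block the value 1, where
-- `(y + m) y^(m−1)` would involve a negative power.
blockFactor : ℕ → ℤ → ℤ
blockFactor zero    y = 1ℤ
blockFactor (suc m) y = (y + + suc m) * y ^ m

eval-T-replicate : ∀ m R y → eval (T (replicate m 0 ++ R)) y ≡ y ^ m * eval (T R) y
eval-T-replicate zero    R y = ≡.sym (ℤ.*-identityˡ _)
eval-T-replicate (suc m) R y = trans (eval-T-∷ 0 (replicate m 0 ++ R) y) (trans
  (cong₂ _*_ (ℤ.+-identityʳ y) (eval-T-replicate m R y)) (≡.sym (ℤ.*-assoc y (y ^ m) _)))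

-- A padding zero contributes no summand of its own and multiplies each of the others by `y`.
eval-U-replicate : ∀ m R y → eval (U (replicate m 0 ++ R)) y ≡ y ^ m * eval (U R) y
eval-U-replicate zero    R y = ≡.sym (ℤ.*-identityˡ _)
eval-U-replicate (suc m) R y = trans (eval-U-∷ 0 (replicate m 0 ++ R) y) (trans
  (cong (λ u → 0ℤ * eval (T (replicate m 0 ++ R)) y + (y + 0ℤ) * u) (eval-U-replicate m R y))
  (simplify (eval (T (replicate m 0 ++ R)) y) y (y ^ m) (eval (U R) y)))
  where
  simplify : ∀ t y z u → 0ℤ * t + (y + 0ℤ) * (z * u) ≡ (y * z) * u
  simplify = solve-∀

eval-T-pad : ∀ m R y → eval (T (pad m ++ R)) y ≡ blockFactor m y * eval (T R) y
eval-T-pad zero    R y = ≡.sym (ℤ.*-identityˡ _)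
eval-T-pad (suc m) R y = trans (eval-T-∷ (suc m) (replicate m 0 ++ R) y)
  (trans (cong ((y + + suc m) *_) (eval-T-replicate m R y)) (≡.sym (ℤ.*-assoc (y + + suc m) (y ^ m) _)))

eval-U-pad : ∀ m R y →
  eval (U (pad m ++ R)) y ≡ + m * (y ^ pred m * eval (T R) y) + blockFactor m y * eval (U R) y
eval-U-pad zero    R y = ≡.sym (trans (ℤ.+-identityˡ _) (ℤ.*-identityˡ _))
eval-U-pad (suc m) R y = trans (eval-U-∷ (suc m) (replicate m 0 ++ R) y)
  (cong₂ (λ t u → + suc m * t + u) (eval-T-replicate m R y)
    (trans (cong ((y + + suc m) *_) (eval-U-replicate m R y)) (≡.sym (ℤ.*-assoc (y + + suc m) (y ^ m) _))))

blockFactor-step : ∀ m y → blockFactor (suc m) y ≡ y * blockFactor m y + y ^ m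
blockFactor-step zero    y = base y
  where
  base : ∀ y → (y + 1ℤ) * 1ℤ ≡ y * 1ℤ + 1ℤ
  base = solve-∀
blockFactor-step (suc m) y = step y (+ suc m) (y ^ m)
  where
  step : ∀ y s z → (y + (1ℤ + s)) * (y * z) ≡ y * ((y + s) * z) + y * z
  step = solve-∀

detℤ-block : ∀ ps y → detℤ (onFin {sumℕ ps} (blockMatrix ps y)) ≡ eval (T (padded ps)) y
detℤ-block []           y = ≡.sym (cong (λ e → 1ℤ + e) (ℤ.*-zeroʳ y))
detℤ-block (m ∷ ps) y = trans (head m) (trans (cong (blockFactor m y *_) (detℤ-block ps y)) (≡.sym (eval-T-pad m (padded ps) y)))
  where
  N : ℕ
  N = sumℕ ps

  d : ℤ
  d = detℤ (onFin {N} (blockMatrix ps y))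

  factor : ∀ y b z d → y * (b * d) + z * d ≡ (y * b + z) * d
  factor = solve-∀

  -- Induction on the size of the first block alone; once it is empty, the matrix computes to that
  -- of `ps`.
  head : ∀ m → detℤ (onFin {m ℕ.+ N} (blockMatrix (m ∷ ps) y)) ≡ blockFactor m y * d
  head zero    = ≡.sym (ℤ.*-identityˡ _)
  head (suc m) = begin
    detℤ (onFin {suc m ℕ.+ N} (blockMatrix (suc m ∷ ps) y))
      ≡⟨ detℤ-block-step m ps N y ⟩
    y * detℤ (onFin {m ℕ.+ N} (blockMatrix (m ∷ ps) y)) + y ^ m * d
      ≡⟨ cong (λ e → y * e + y ^ m * d) (head m) ⟩
    y * (blockFactor m y * d) + y ^ m * d
      ≡⟨ factor y (blockFactor m y) (y ^ m) d ⟩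
    (y * blockFactor m y + y ^ m) * d
      ≡⟨ cong (_* d) (≡.sym (blockFactor-step m y)) ⟩
    blockFactor (suc m) y * d ∎

-- Block indices and the solution of B w = (1, ..., 1)

<ᵇ-true : ∀ {i m} → i ℕ.< m → (i <ᵇ m) ≡ true
<ᵇ-true {zero}  {suc m} _        = refl
<ᵇ-true {suc i} {suc m} (s≤s lt) = <ᵇ-true lt

+-<ᵇ-false : ∀ m i → (m ℕ.+ i <ᵇ m) ≡ false
+-<ᵇ-false zero    i = refl
+-<ᵇ-false (suc m) i = +-<ᵇ-false m i

≡ᵇ-+-cancel : ∀ m i j → (m ℕ.+ i ≡ᵇ m ℕ.+ j) ≡ (i ≡ᵇ j)
≡ᵇ-+-cancel zero    i j = refl
≡ᵇ-+-cancel (suc m) i j = ≡ᵇ-+-cancel m i j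

≡ᵇ-+-right : ∀ {i m} j → i ℕ.< m → (i ≡ᵇ m ℕ.+ j) ≡ false
≡ᵇ-+-right {zero}  {suc m} j _        = refl
≡ᵇ-+-right {suc i} {suc m} j (s≤s lt) = ≡ᵇ-+-right j lt

≡ᵇ-+-left : ∀ {j m} i → j ℕ.< m → (m ℕ.+ i ≡ᵇ j) ≡ false
≡ᵇ-+-left {zero}  {suc m} i _        = refl
≡ᵇ-+-left {suc j} {suc m} i (s≤s lt) = ≡ᵇ-+-left i lt

blockOf-head : ∀ {m i} ps → i ℕ.< m → blockOf (m ∷ ps) i ≡ 0
blockOf-head ps lt rewrite <ᵇ-true lt = refl

blockOf-tail : ∀ m ps i → blockOf (m ∷ ps) (m ℕ.+ i) ≡ suc (blockOf ps i)
blockOf-tail m ps i rewrite +-<ᵇ-false m i | ℕ.m+n∸m≡n m i = refl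

-- T times the solution w of B w = (1, …, 1), namely T / (y + n_i) on the i-th block.
weight : List ℕ → ℤ → ℕ → ℤ
weight []       y i = 0ℤ
weight (m ∷ ps) y i =
  if i <ᵇ m then y ^ pred m * eval (T (padded ps)) y else blockFactor m y * weight ps y (i ∸ m)

weight-head : ∀ {m i} ps y → i ℕ.< m → weight (m ∷ ps) y i ≡ y ^ pred m * eval (T (padded ps)) y
weight-head ps y lt rewrite <ᵇ-true lt = refl

weight-tail : ∀ m ps y i → weight (m ∷ ps) y (m ℕ.+ i) ≡ blockFactor m y * weight ps y i
weight-tail m ps y i rewrite +-<ᵇ-false m i | ℕ.m+n∸m≡n m i = refl

sum-split : ∀ m {n} (f : ℕ → ℤ) →
  sum {m ℕ.+ n} (f ∘ toℕ) ≡ sum {m} (f ∘ toℕ) + sum {n} (λ i → f (m ℕ.+ toℕ i))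
sum-split zero    f = ≡.sym (ℤ.+-identityˡ _)
sum-split (suc m) f = trans (cong (λ s → f 0 + s) (sum-split m (f ∘ suc))) (≡.sym (ℤ.+-assoc (f 0) _ _))

sum-const : ∀ m c → sum {m} (λ _ → c) ≡ + m * c
sum-const zero    c = refl
sum-const (suc m) c = trans (cong (λ s → c + s) (sum-const m c)) (step c (+ m))
  where
  step : ∀ c m → c + m * c ≡ (1ℤ + m) * c
  step = solve-∀

-- A block of size `n_i` contributes `n_i` copies of `T / (y + n_i)`, which is one summand of U.
sum-weight : ∀ ps y → sum {sumℕ ps} (weight ps y ∘ toℕ) ≡ eval (U (padded ps)) y
sum-weight []       y = refl
sum-weight (m ∷ ps) y = begin
  sum {m ℕ.+ N} (weight (m ∷ ps) y ∘ toℕ)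
    ≡⟨ sum-split m (weight (m ∷ ps) y) ⟩
  sum {m} (weight (m ∷ ps) y ∘ toℕ) + sum {N} (λ i → weight (m ∷ ps) y (m ℕ.+ toℕ i))
    ≡⟨ cong₂ _+_
         (trans (sum-cong-≋ λ i → weight-head ps y (Fin.toℕ<n {m} i)) (sum-const m _))
         (trans (sum-cong-≋ {N} λ i → weight-tail m ps y (toℕ i))
           (trans (≡.sym (*-distribˡ-sum {N} (blockFactor m y) (weight ps y ∘ toℕ))) (cong (blockFactor m y *_) (sum-weight ps y)))) ⟩
  + m * (y ^ pred m * eval (T (padded ps)) y) + blockFactor m y * eval (U (padded ps)) y
    ≡⟨ ≡.sym (eval-U-pad m (padded ps) y) ⟩
  eval (U (padded (m ∷ ps))) y ∎
  where
  N : ℕ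
  N = sumℕ ps

-- A constant vector is an eigenvector of `y I + J_m` with eigenvalue `y + m`.
sum-block-row : ∀ {m i} c y → i ℕ.< m → sum {m} (λ j → c * (y * ⟦ i ≡ᵇ toℕ j ⟧ + 1ℤ)) ≡ c * (y + + m)
sum-block-row {suc m} {zero} c y _ = trans
  (cong (λ s → c * (y * 1ℤ + 1ℤ) + s) (sum-const m (c * (y * 0ℤ + 1ℤ))))
  (collect c y (+ m))
  where
  collect : ∀ c y m → c * (y * 1ℤ + 1ℤ) + m * (c * (y * 0ℤ + 1ℤ)) ≡ c * (y + (1ℤ + m))
  collect = solve-∀
sum-block-row {suc m} {suc i} c y (s≤s lt) = trans
  (cong (λ s → c * (y * 0ℤ + 1ℤ) + s) (sum-block-row c y lt))
  (collect c y (+ m))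
  where
  collect : ∀ c y m → c * (y * 0ℤ + 1ℤ) + c * (y + m) ≡ c * (y + (1ℤ + m))
  collect = solve-∀

-- Entries between the first block and the rest vanish. A row of the first block restores the
-- missing factor `y + m` of its weight; a row further on reduces to `ps`, with `blockFactor m y`
-- taken out of the sum.
weight-solves : ∀ ps y i → i ℕ.< sumℕ ps →
  sum {sumℕ ps} (λ j → weight ps y (toℕ j) * blockMatrix ps y i (toℕ j)) ≡ eval (T (padded ps)) y
weight-solves (m ∷ ps) y i i<m+N = trans (sum-split m (row i)) (by-block (i ℕ.<? m))
  where
  N : ℕ
  N = sumℕ ps

  t : ℤ
  t = eval (T (padded ps)) y

  row : ℕ → ℕ → ℤ
  row i j = weight (m ∷ ps) y j * blockMatrix (m ∷ ps) y i j

  vanish : ∀ w {e b} → e ≡ false → b ≡ false → w * (y * ⟦ e ⟧ + ⟦ b ⟧) ≡ 0ℤ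
  vanish w refl refl = trans (cong (w *_) (y*0+0 y)) (ℤ.*-zeroʳ w)

  different-head : ∀ {i} j → i ℕ.< m → (i ≈[ m ∷ ps ] (m ℕ.+ j)) ≡ false
  different-head j lt = cong₂ _≡ᵇ_ (blockOf-head ps lt) (blockOf-tail m ps j)

  different-tail : ∀ i {j} → j ℕ.< m → ((m ℕ.+ i) ≈[ m ∷ ps ] j) ≡ false
  different-tail i lt = cong₂ _≡ᵇ_ (blockOf-tail m ps i) (blockOf-head ps lt)

  head-factor : ∀ {m i} → i ℕ.< m → (y ^ pred m * t) * (y + + m) ≡ blockFactor m y * t
  head-factor {suc m} _ = reorder (y ^ m) t (y + + suc m)
    where
    reorder : ∀ z t s → (z * t) * s ≡ (s * z) * t
    reorder = solve-∀

  in-tail : ∀ i → i ℕ.< N →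
    sum {m} (λ j → row (m ℕ.+ i) (toℕ j)) + sum {N} (λ j → row (m ℕ.+ i) (m ℕ.+ toℕ j)) ≡ eval (T (padded (m ∷ ps))) y
  in-tail i i<N = begin
    sum {m} (λ j → row (m ℕ.+ i) (toℕ j)) + sum {N} (λ j → row (m ℕ.+ i) (m ℕ.+ toℕ j))
      ≡⟨ cong₂ _+_
           (sum-zero {m} _ λ j → vanish (weight (m ∷ ps) y (toℕ j)) (≡ᵇ-+-left i (Fin.toℕ<n j)) (different-tail i (Fin.toℕ<n j)))
           (sum-cong-≋ {N} λ j → trans
             (cong₂ _*_ (weight-tail m ps y (toℕ j))
               (cong₂ (λ e b → y * ⟦ e ⟧ + ⟦ b ⟧) (≡ᵇ-+-cancel m i (toℕ j))
                 (cong₂ _≡ᵇ_ (blockOf-tail m ps i) (blockOf-tail m ps (toℕ j)))))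
             (ℤ.*-assoc (blockFactor m y) _ _)) ⟩
    0ℤ + sum {N} (λ j → blockFactor m y * (weight ps y (toℕ j) * blockMatrix ps y i (toℕ j)))
      ≡⟨ trans (ℤ.+-identityˡ _) (≡.sym (*-distribˡ-sum {N} (blockFactor m y) _)) ⟩
    blockFactor m y * sum {N} (λ j → weight ps y (toℕ j) * blockMatrix ps y i (toℕ j))
      ≡⟨ cong (blockFactor m y *_) (weight-solves ps y i i<N) ⟩
    blockFactor m y * t
      ≡⟨ ≡.sym (eval-T-pad m (padded ps) y) ⟩
    eval (T (padded (m ∷ ps))) y ∎

  by-block : Dec (i ℕ.< m) →
    sum {m} (λ j → row i (toℕ j)) + sum {N} (λ j → row i (m ℕ.+ toℕ j)) ≡ eval (T (padded (m ∷ ps))) y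
  by-block (yes i<m) = begin
    sum {m} (λ j → row i (toℕ j)) + sum {N} (λ j → row i (m ℕ.+ toℕ j))
      ≡⟨ cong₂ _+_
           (sum-cong-≋ {m} λ j → cong₂ _*_ (weight-head ps y (Fin.toℕ<n j))
             (cong (λ b → y * ⟦ i ≡ᵇ toℕ j ⟧ + ⟦ b ⟧) (cong₂ _≡ᵇ_ (blockOf-head ps i<m) (blockOf-head ps (Fin.toℕ<n j)))))
           (sum-zero {N} _ λ j → vanish (weight (m ∷ ps) y (m ℕ.+ toℕ j)) (≡ᵇ-+-right (toℕ j) i<m) (different-head (toℕ j) i<m)) ⟩
    sum {m} (λ j → (y ^ pred m * t) * (y * ⟦ i ≡ᵇ toℕ j ⟧ + 1ℤ)) + 0ℤ
      ≡⟨ trans (ℤ.+-identityʳ _) (sum-block-row (y ^ pred m * t) y i<m) ⟩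
    (y ^ pred m * t) * (y + + m)
      ≡⟨ head-factor i<m ⟩
    blockFactor m y * t
      ≡⟨ ≡.sym (eval-T-pad m (padded ps) y) ⟩
    eval (T (padded (m ∷ ps))) y ∎
  by-block (no i≮m) with ℕ.m+[n∸m]≡n (ℕ.≮⇒≥ i≮m)
  ... | m+[i∸m]≡i = subst
    (λ i → sum {m} (λ j → row i (toℕ j)) + sum {N} (λ j → row i (m ℕ.+ toℕ j)) ≡ eval (T (padded (m ∷ ps))) y)
    m+[i∸m]≡i
    (in-tail (i ∸ m) (ℕ.+-cancelˡ-< m (i ∸ m) N (subst (ℕ._< m ℕ.+ N) (≡.sym m+[i∸m]≡i) i<m+N)))

-- Distances and the characteristic polynomial

≡ᵇ-refl : ∀ i → (i ≡ᵇ i) ≡ true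
≡ᵇ-refl zero    = refl
≡ᵇ-refl (suc i) = ≡ᵇ-refl i

≢⇒≡ᵇ-false : ∀ {n} {i j : Fin n} → i ≢ j → (toℕ i ≡ᵇ toℕ j) ≡ false
≢⇒≡ᵇ-false {i = zero}  {zero}  i≢j = contradiction refl i≢j
≢⇒≡ᵇ-false {i = zero}  {suc j} i≢j = refl
≢⇒≡ᵇ-false {i = suc i} {zero}  i≢j = refl
≢⇒≡ᵇ-false {i = suc i} {suc j} i≢j = ≢⇒≡ᵇ-false (i≢j ∘ cong suc)

-- A guard that holds only at `u` collapses the disjunction to `h u`. In `reach` the guard says that
-- a walk of length 0 has not left its start.
any-tabulate : ∀ {a} {A : Set a} {n} (p : A → Bool) (g : Fin n → A) (h : Fin n → Bool) (u : Fin n) →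
  (∀ w → p (g w) ≡ (toℕ u ≡ᵇ toℕ w) ∧ h w) → any p (List.tabulate g) ≡ h u
any-tabulate p g h zero    eq = trans
  (cong₂ _∨_ (eq zero) (none (g ∘ suc) (eq ∘ suc)))
  (Bool.∨-identityʳ (h zero))
  where
  none : ∀ {n} (g : Fin n → _) → (∀ w → p (g w) ≡ false) → any p (List.tabulate g) ≡ false
  none {zero}  g eq = refl
  none {suc n} g eq = cong₂ _∨_ (eq zero) (none (g ∘ suc) (eq ∘ suc))
any-tabulate p g h (suc u) eq = cong₂ _∨_ (eq zero) (any-tabulate p (g ∘ suc) (h ∘ suc) u (eq ∘ suc))

⌊≟⌋ : ∀ {n} (i j : Fin n) → ⌊ i Fin.≟ j ⌋ ≡ (toℕ i ≡ᵇ toℕ j)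
⌊≟⌋ i j with i Fin.≟ j
... | yes refl = ≡.sym (≡ᵇ-refl (toℕ i))
... | no i≢j   = ≡.sym (≢⇒≡ᵇ-false i≢j)

reach-1 : ∀ {n} (G : SimpleGraph n) u v → reach G 1 u v ≡ (toℕ u ≡ᵇ toℕ v) ∨ adj G u v
reach-1 G u v = cong₂ _∨_ (⌊≟⌋ u v)
  (any-tabulate _ id (λ w → adj G w v) u (λ w → cong (_∧ adj G w v) (⌊≟⌋ u w)))

-- The walk goes through v, the first intermediate vertex that `any` tries.
reach-2-K : ∀ {n} ps (i j : Fin n) → reach (K (suc n) ps) 2 (suc i) (suc j) ≡ true
reach-2-K {n} ps i j = trans
  (cong (λ b → reach (K (suc n) ps) 1 (suc i) (suc j) ∨ (b ∨ rest))
    (cong (_∧ true) (reach-1 (K (suc n) ps) (suc i) zero)))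
  (Bool.∨-zeroʳ (reach (K (suc n) ps) 1 (suc i) (suc j)))
  where
  rest : Bool
  rest = any (λ w → reach (K (suc n) ps) 1 (suc i) w ∧ adjK ps w (suc j)) (List.tabulate suc)

dist-v-right : ∀ {n} ps (i : Fin (suc n)) → dist (K (suc (suc n)) ps) (suc i) zero ≡ 1
dist-v-right {n} ps i = cong (λ b → if b then 1 else distSearch (K (suc (suc n)) ps) (suc i) zero n 2)
  (reach-1 (K (suc (suc n)) ps) (suc i) zero)

dist-v-left : ∀ {n} ps (j : Fin (suc n)) → dist (K (suc (suc n)) ps) zero (suc j) ≡ 1
dist-v-left {n} ps j = cong (λ b → if b then 1 else distSearch (K (suc (suc n)) ps) zero (suc j) n 2)
  (reach-1 (K (suc (suc n)) ps) zero (suc j))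

dist-others : ∀ {n} ps (i j : Fin (suc n)) →
  dist (K (suc (suc n)) ps) (suc i) (suc j) ≡
  (if toℕ i ≡ᵇ toℕ j then 0 else (if toℕ i ≈[ ps ] toℕ j then 1 else 2))
dist-others {n} ps i j rewrite reach-1 (K (suc (suc n)) ps) (suc i) (suc j) | ⌊≟⌋ (suc i) (suc j)
  with toℕ i ≡ᵇ toℕ j
... | true  = refl
... | false = cong (λ d → if toℕ i ≈[ ps ] toℕ j then 1 else d) (search-2 n)
  where
  -- If the fuel runs out here, `distSearch` returns its current counter, which is also 2.
  search-2 : ∀ f → distSearch (K (suc (suc n)) ps) (suc i) (suc j) f 2 ≡ 2
  search-2 zero    = refl
  search-2 (suc f) = cong (λ b → if b then 2 else distSearch (K (suc (suc n)) ps) (suc i) (suc j) f 3) (reach-2-K ps i j)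

-- Evaluating the characteristic polynomial

eval-sign : ∀ k x → eval (if ⌊ k ℕ.% 2 ℕ.≟ 0 ⌋ then (+ 1 ∷ []) else (- + 1 ∷ [])) x ≡ sgn k
eval-sign zero          x = cong (λ e → 1ℤ + e) (ℤ.*-zeroʳ x)
eval-sign (suc zero)    x = cong (λ e → - 1ℤ + e) (ℤ.*-zeroʳ x)
-- `suc (suc k) % 2` computes to `k % 2`, so the induction goes in steps of two.
eval-sign (suc (suc k)) x = trans (eval-sign k x) (≡.sym (ℤ.neg-involutive (sgn k)))

eval-foldr-tabulate : ∀ {a} {A : Set a} {n} (h : A → Poly) (g : Fin n → A) x →
  eval (List.foldr _+P_ [] (List.map h (List.tabulate g))) x ≡ sum λ j → eval (h (g j)) x
eval-foldr-tabulate {n = zero}  h g x = refl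
eval-foldr-tabulate {n = suc n} h g x =
  trans (eval-+P (h (g zero)) _ x) (cong (λ s → eval (h (g zero)) x + s) (eval-foldr-tabulate h (g ∘ suc) x))

-- Evaluation respects sums and products, hence the expansion; this carries the problem from
-- matrices of coefficient lists to integer matrices, where the column operations are available.
eval-det : ∀ {m} (M : Fin m → Fin m → Poly) x → eval (det M) x ≡ detℤ (λ i j → eval (M i j) x)
eval-det {zero}  M x = cong (λ e → 1ℤ + e) (ℤ.*-zeroʳ x)
eval-det {suc m} M x = trans (eval-foldr-tabulate term id x) (sum-cong-≋ eval-term)
  where
  sign : Fin (suc m) → Poly
  sign j = if ⌊ toℕ j ℕ.% 2 ℕ.≟ 0 ⌋ then (+ 1 ∷ []) else (- + 1 ∷ [])

  sub : Fin (suc m) → Fin m → Fin m → Poly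
  sub j r c = M (suc r) (punchIn j c)

  term : Fin (suc m) → Poly
  term j = (sign j *P M zero j) *P det (sub j)

  eval-term : ∀ j → eval (term j) x ≡ (sgn (toℕ j) * eval (M zero j) x) * detℤ (λ r c → eval (sub j r c) x)
  eval-term j = trans (eval-*P (sign j *P M zero j) (det (sub j)) x)
    (cong₂ _*_ (trans (eval-*P (sign j) (M zero j) x) (cong (_* eval (M zero j) x) (eval-sign (toℕ j) x)))
      (eval-det (sub j) x))

eval-charPoly : ∀ {m} (M : Matrix m) x →
  eval (charPoly M) x ≡ detℤ (λ i j → x * ⟦ toℕ i ≡ᵇ toℕ j ⟧ + - M i j)
eval-charPoly M x = trans (eval-det entry x) (detℤ-cong eval-entry)
  where
  entry : Fin _ → Fin _ → Poly
  entry i j = if ⌊ i Fin.≟ j ⌋ then (- M i j ∷ + 1 ∷ []) else (- M i j ∷ [])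

  diagonal : ∀ x a → a + x * (1ℤ + x * 0ℤ) ≡ x * 1ℤ + a
  diagonal = solve-∀

  off-diagonal : ∀ x a → a + x * 0ℤ ≡ x * 0ℤ + a
  off-diagonal = solve-∀

  eval-entry : ∀ i j → eval (entry i j) x ≡ x * ⟦ toℕ i ≡ᵇ toℕ j ⟧ + - M i j
  eval-entry i j with i Fin.≟ j
  ... | yes refl rewrite ≡ᵇ-refl (toℕ i)  = diagonal x (- M i i)
  ... | no i≢j   rewrite ≢⇒≡ᵇ-false i≢j = off-diagonal x (- M i j)

module _ (ps : List ℕ) (y : ℤ) where
  private
    N : ℕ
    N = sumℕ ps

    x t u : ℤ
    x = y + - 1ℤ
    t = eval (T (padded ps)) y
    u = eval (U (padded ps)) y

  borderColumn : Fin (suc N) → ℤ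
  borderColumn zero    = x
  borderColumn (suc i) = - 1ℤ

  -- The parameters serve two stages: `(−1, −2)` gives the columns of `x I − D`, and `(−1 − 2x, 0)`
  -- those left after subtracting twice the column of v.
  restColumns : ℤ → ℤ → Fin (suc N) → Fin N → ℤ
  restColumns top shift zero    j = top
  restColumns top shift (suc i) j = blockMatrix ps y (toℕ i) (toℕ j) + shift

  private
    C : Fin (suc N) → Fin N → ℤ
    C = restColumns (- 1ℤ + - + 2 * x) 0ℤ

  -- The factor `t` on the left pays for scaling the column of v by T. Adding the weighted columns
  -- then turns each lower entry into `−t + t` and the top entry into χ; what remains is `det B`,
  -- which is again `t`.
  detℤ-bordered : t * detℤ [ borderColumn ∣ restColumns (- 1ℤ) (- + 2) ] ≡ t * eval (χ (padded ps)) y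
  detℤ-bordered = begin
    t * detℤ [ borderColumn ∣ restColumns (- 1ℤ) (- + 2) ]
      ≡⟨ cong (t *_) (≡.sym (detℤ-add-first-to-others (λ _ → - + 2) borderColumn (restColumns (- 1ℤ) (- + 2)))) ⟩
    t * detℤ [ borderColumn ∣ (λ i j → restColumns (- 1ℤ) (- + 2) i j + - + 2 * borderColumn i) ]
      ≡⟨ cong (t *_) (detℤ-cong
           {A = [ borderColumn ∣ (λ i j → restColumns (- 1ℤ) (- + 2) i j + - + 2 * borderColumn i) ]}
           {B = [ borderColumn ∣ C ]}
           λ { i zero → refl ; zero (suc j) → refl ; (suc i) (suc j) → cancel (blockMatrix ps y (toℕ i) (toℕ j)) }) ⟩
    t * detℤ [ borderColumn ∣ C ]
      ≡⟨ ≡.sym (detℤ-combine-into-first t (weight ps y ∘ toℕ) borderColumn C) ⟩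
    detℤ [ combined ∣ C ]
      ≡⟨ detℤ-first-column [ combined ∣ C ] combined-below ⟩
    combined zero * detℤ {N} (λ i j → blockMatrix ps y (toℕ i) (toℕ j) + 0ℤ)
      ≡⟨ cong₂ _*_ combined-top (trans (detℤ-cong {N} λ i j → ℤ.+-identityʳ (blockMatrix ps y (toℕ i) (toℕ j))) (detℤ-block ps y)) ⟩
    eval (χ (padded ps)) y * t
      ≡⟨ ℤ.*-comm (eval (χ (padded ps)) y) t ⟩
    t * eval (χ (padded ps)) y ∎
    where
    cancel : ∀ b → (b + - + 2) + - + 2 * - 1ℤ ≡ b + 0ℤ
    cancel = solve-∀

    combined : Fin (suc N) → ℤ
    combined i = t * borderColumn i + sum {N} (λ j → weight ps y (toℕ j) * C i j)

    combined-below : ∀ i → combined (suc i) ≡ 0ℤ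
    combined-below i = trans
      (cong (λ s → t * - 1ℤ + s) (trans
        (sum-cong-≋ {N} λ j → cong (weight ps y (toℕ j) *_) (ℤ.+-identityʳ (blockMatrix ps y (toℕ i) (toℕ j))))
        (weight-solves ps y (toℕ i) (Fin.toℕ<n i))))
      (opposite t)
      where
      opposite : ∀ t → t * - 1ℤ + t ≡ 0ℤ
      opposite = solve-∀

    combined-top : combined zero ≡ eval (χ (padded ps)) y
    combined-top = begin
      t * x + sum {N} (λ j → weight ps y (toℕ j) * (- 1ℤ + - + 2 * x))
        ≡⟨ cong (λ s → t * x + s) (trans
             (sum-cong-≋ {N} λ j → ℤ.*-comm (weight ps y (toℕ j)) (- 1ℤ + - + 2 * x))
             (trans (≡.sym (*-distribˡ-sum {N} (- 1ℤ + - + 2 * x) (weight ps y ∘ toℕ)))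
               (cong ((- 1ℤ + - + 2 * x) *_) (sum-weight ps y)))) ⟩
      t * x + (- 1ℤ + - + 2 * x) * u
        ≡⟨ regroup y t u ⟩
      (y + - 1ℤ) * t + (1ℤ + - + 2 * y) * u
        ≡⟨ ≡.sym (eval-χ (padded ps) y) ⟩
      eval (χ (padded ps)) y ∎
      where
      regroup : ∀ y t u → t * (y + - 1ℤ) + (- 1ℤ + - + 2 * (y + - 1ℤ)) * u ≡ (y + - 1ℤ) * t + (1ℤ + - + 2 * y) * u
      regroup = solve-∀

  private
    others : ∀ {n} (i j : Fin n) →
      x * ⟦ toℕ i ≡ᵇ toℕ j ⟧ + - + (if toℕ i ≡ᵇ toℕ j then 0 else (if toℕ i ≈[ ps ] toℕ j then 1 else 2))
      ≡ blockMatrix ps y (toℕ i) (toℕ j) + - + 2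
    others i j with i Fin.≟ j
    ... | yes refl rewrite ≡ᵇ-refl (toℕ i) | ≡ᵇ-refl (blockOf ps (toℕ i)) = on-diagonal y
      where
      on-diagonal : ∀ y → (y + - 1ℤ) * 1ℤ + 0ℤ ≡ (y * 1ℤ + 1ℤ) + - + 2
      on-diagonal = solve-∀
    ... | no i≢j rewrite ≢⇒≡ᵇ-false i≢j with toℕ i ≈[ ps ] toℕ j
    ...   | true  = same-block y
      where
      same-block : ∀ y → (y + - 1ℤ) * 0ℤ + - 1ℤ ≡ (y * 0ℤ + 1ℤ) + - + 2
      same-block = solve-∀
    ...   | false = different-blocks y
      where
      different-blocks : ∀ y → (y + - 1ℤ) * 0ℤ + - + 2 ≡ (y * 0ℤ + 0ℤ) + - + 2
      different-blocks = solve-∀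

    beside-v : ∀ x → x * 0ℤ + - 1ℤ ≡ - 1ℤ
    beside-v = solve-∀

  charMatrix-K : 1 ≤ N → ∀ i j →
    x * ⟦ toℕ i ≡ᵇ toℕ j ⟧ + - distMatrix (K (suc N) ps) i j ≡ [ borderColumn ∣ restColumns (- 1ℤ) (- + 2) ] i j
  charMatrix-K 1≤N zero zero = trans (ℤ.+-identityʳ (x * 1ℤ)) (ℤ.*-identityʳ x)
  -- The distance lemmas speak of at least one vertex besides v, so the sum of the block sizes has
  -- to be exposed as a successor.
  charMatrix-K 1≤N zero (suc j) with sumℕ ps | 1≤N | j
  ... | suc n | s≤s _ | j = trans (cong (λ d → x * 0ℤ + - + d) (dist-v-left ps j)) (beside-v x)
  charMatrix-K 1≤N (suc i) zero with sumℕ ps | 1≤N | i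
  ... | suc n | s≤s _ | i = trans (cong (λ d → x * 0ℤ + - + d) (dist-v-right ps i)) (beside-v x)
  charMatrix-K 1≤N (suc i) (suc j) with sumℕ ps | 1≤N | i | j
  ... | suc n | s≤s _ | i | j = trans (cong (λ d → x * ⟦ toℕ i ≡ᵇ toℕ j ⟧ + - + d) (dist-others ps i j)) (others i j)

-- Positivity of `y` is what allows the factor T to be cancelled from `detℤ-bordered`.
eval-charPoly-K : ∀ ps {N} → sumℕ ps ≡ N → 1 ≤ N → ∀ k →
  eval (charPoly (distMatrix (K (suc N) ps))) (+ suc k + - 1ℤ) ≡ eval (χ (padded ps)) (+ suc k)
eval-charPoly-K ps refl 1≤N k = trans (eval-charPoly (distMatrix (K (suc (sumℕ ps)) ps)) (y + - 1ℤ)) (trans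
  (detℤ-cong {B = [ borderColumn ps y ∣ restColumns ps y (- 1ℤ) (- + 2) ]} (charMatrix-K ps y 1≤N))
  (ℤ.*-cancelˡ-≡ (eval (T (padded ps)) y) _ _ {{≢-nonZero (eval-T≢0 (padded ps) k)}} (detℤ-bordered ps y)))
  where
  y : ℤ
  y = + suc k

-- Cospectrality and isomorphism

-- The shift between `x` and `y` mixes coefficients, so the hypothesis is turned into equality of
-- values at `x = y − 1`, and these back into coefficients in `y`.
DCospectral⇒coeff-χ≡ : ∀ {N} ps qs → 1 ≤ N → sumℕ ps ≡ N → sumℕ qs ≡ N →
  DCospectral (K (suc N) ps) (K (suc N) qs) → ∀ i → coeff (χ (padded ps)) i ≡ coeff (χ (padded qs)) i
DCospectral⇒coeff-χ≡ {N} ps qs 1≤N Σps Σqs cospectral =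
  eventually-≡⇒coeff≡ (χ (padded ps)) (χ (padded qs)) 1 λ where
    (suc k) _ → trans (≡.sym (eval-charPoly-K ps Σps 1≤N k)) (trans
      (coeff≡⇒eval≡ (charPoly (distMatrix (K (suc N) ps))) (charPoly (distMatrix (K (suc N) qs))) cospectral (+ suc k + - 1ℤ))
      (eval-charPoly-K qs Σqs 1≤N k))

length-padded : ∀ ps → length (padded ps) ≡ sumℕ ps
length-padded []       = refl
length-padded (m ∷ ps) = trans (List.length-++ (pad m)) (cong₂ ℕ._+_ (length-pad m) (length-padded ps))
  where
  length-pad : ∀ m → length (pad m) ≡ m
  length-pad zero    = refl
  length-pad (suc m) = cong suc (List.length-replicate m)

-- Block sizes are positive, so dropping the zeros undoes the padding exactly; a permutation of
-- padded lists then restricts to one of the block sizes.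
filter-padded : ∀ {ps} → All (1 ≤_) ps → List.filter (1 ℕ.≤?_) (padded ps) ≡ ps
filter-padded []                           = refl
filter-padded {suc m ∷ ps} (_ ∷ ps≥1) = cong (suc m ∷_) (trans (drop-zeros m (padded ps)) (filter-padded ps≥1))
  where
  drop-zeros : ∀ m R → List.filter (1 ℕ.≤?_) (replicate m 0 ++ R) ≡ List.filter (1 ℕ.≤?_) R
  drop-zeros zero    R = refl
  drop-zeros (suc m) R = drop-zeros m R

DCospectral⇒↭ : ∀ {N} ps qs → 1 ≤ N → sumℕ ps ≡ N → sumℕ qs ≡ N → All (1 ≤_) ps → All (1 ≤_) qs →
  DCospectral (K (suc N) ps) (K (suc N) qs) → ps ↭ qs
DCospectral⇒↭ ps qs 1≤N Σps Σqs ps≥1 qs≥1 cospectral = ↭-trans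
  (↭-reflexive (≡.sym (filter-padded ps≥1)))
  (↭-trans
    (filter-↭ (1 ℕ.≤?_) (T-determines-roots (padded ps) (padded qs)
      (χ-determines-T (padded ps) (padded qs)
        (trans (trans (length-padded ps) Σps) (≡.sym (trans (length-padded qs) Σqs)))
        (DCospectral⇒coeff-χ≡ ps qs 1≤N Σps Σqs cospectral))))
    (↭-reflexive (filter-padded qs≥1)))

-- The vertices other than v as a disjoint union of blocks: permuting blocks merely rearranges
-- summands, with no arithmetic on consecutive intervals.
Vertex : List ℕ → Set
Vertex []       = ⊥
Vertex (m ∷ ps) = Fin m ⊎ Vertex ps

sameBlock : ∀ ps → Vertex ps → Vertex ps → Bool
sameBlock (m ∷ ps) (inj₁ _) (inj₁ _) = true
sameBlock (m ∷ ps) (inj₁ _) (inj₂ _) = false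
sameBlock (m ∷ ps) (inj₂ _) (inj₁ _) = false
sameBlock (m ∷ ps) (inj₂ v) (inj₂ w) = sameBlock ps v w

Vertex-↭ : ∀ {ps qs} → ps ↭ qs →
  Σ (Vertex ps ↔ Vertex qs) λ σ → ∀ v w → sameBlock ps v w ≡ sameBlock qs (Inverse.to σ v) (Inverse.to σ w)
Vertex-↭ Perm.refl = ↔-refl , λ v w → refl
Vertex-↭ (Perm.prep m p) with Vertex-↭ p
... | σ , same = (↔-refl ⊎-↔ σ) , λ where
  (inj₁ _) (inj₁ _) → refl
  (inj₁ _) (inj₂ _) → refl
  (inj₂ _) (inj₁ _) → refl
  (inj₂ v) (inj₂ w) → same v w
Vertex-↭ {a ∷ b ∷ ps} {_ ∷ _ ∷ qs} (Perm.swap a b p) with Vertex-↭ p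
... | σ , same = mk↔ₛ′ to from to∘from from∘to , preserves
  where
  to : Vertex (a ∷ b ∷ ps) → Vertex (b ∷ a ∷ qs)
  to (inj₁ i)        = inj₂ (inj₁ i)
  to (inj₂ (inj₁ j)) = inj₁ j
  to (inj₂ (inj₂ v)) = inj₂ (inj₂ (Inverse.to σ v))

  from : Vertex (b ∷ a ∷ qs) → Vertex (a ∷ b ∷ ps)
  from (inj₁ j)        = inj₂ (inj₁ j)
  from (inj₂ (inj₁ i)) = inj₁ i
  from (inj₂ (inj₂ v)) = inj₂ (inj₂ (Inverse.from σ v))

  to∘from : ∀ v → to (from v) ≡ v
  to∘from (inj₁ j)        = refl
  to∘from (inj₂ (inj₁ i)) = refl
  to∘from (inj₂ (inj₂ v)) = cong (inj₂ ∘ inj₂) (Inverse.strictlyInverseˡ σ v)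

  from∘to : ∀ v → from (to v) ≡ v
  from∘to (inj₁ j)        = refl
  from∘to (inj₂ (inj₁ i)) = refl
  from∘to (inj₂ (inj₂ v)) = cong (inj₂ ∘ inj₂) (Inverse.strictlyInverseʳ σ v)

  preserves : ∀ v w → sameBlock (a ∷ b ∷ ps) v w ≡ sameBlock (b ∷ a ∷ qs) (to v) (to w)
  preserves (inj₁ _)        (inj₁ _)        = refl
  preserves (inj₁ _)        (inj₂ (inj₁ _)) = refl
  preserves (inj₁ _)        (inj₂ (inj₂ _)) = refl
  preserves (inj₂ (inj₁ _)) (inj₁ _)        = refl
  preserves (inj₂ (inj₁ _)) (inj₂ (inj₁ _)) = refl
  preserves (inj₂ (inj₁ _)) (inj₂ (inj₂ _)) = refl
  preserves (inj₂ (inj₂ _)) (inj₁ _)        = refl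
  preserves (inj₂ (inj₂ _)) (inj₂ (inj₁ _)) = refl
  preserves (inj₂ (inj₂ v)) (inj₂ (inj₂ w)) = same v w
Vertex-↭ (Perm.trans p q) with Vertex-↭ p | Vertex-↭ q
... | σ , same | τ , same′ =
  ↔-trans σ τ , λ v w → trans (same v w) (same′ (Inverse.to σ v) (Inverse.to σ w))

enumerate : ∀ ps → Vertex ps ↔ Fin (sumℕ ps)
enumerate []       = ↔-sym Fin.0↔⊥
enumerate (m ∷ ps) = ↔-trans (↔-refl ⊎-↔ enumerate ps) (↔-sym Fin.+↔⊎)

blockOf-enumerate : ∀ ps v w →
  (toℕ (Inverse.to (enumerate ps) v) ≈[ ps ] toℕ (Inverse.to (enumerate ps) w)) ≡ sameBlock ps v w
blockOf-enumerate (m ∷ ps) = λ where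
    (inj₁ i) (inj₁ j) → cong₂ _≡ᵇ_ (first i) (first j)
    (inj₁ i) (inj₂ w) → cong₂ _≡ᵇ_ (first i) (later w)
    (inj₂ v) (inj₁ j) → cong₂ _≡ᵇ_ (later v) (first j)
    (inj₂ v) (inj₂ w) → trans (cong₂ _≡ᵇ_ (later v) (later w)) (blockOf-enumerate ps v w)
  where
  first : ∀ i → blockOf (m ∷ ps) (toℕ (i Fin.↑ˡ sumℕ ps)) ≡ 0
  first i = trans (cong (blockOf (m ∷ ps)) (Fin.toℕ-↑ˡ i (sumℕ ps))) (blockOf-head ps (Fin.toℕ<n i))

  later : ∀ v → blockOf (m ∷ ps) (toℕ (m Fin.↑ʳ Inverse.to (enumerate ps) v))
    ≡ suc (blockOf ps (toℕ (Inverse.to (enumerate ps) v)))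
  later v = trans (cong (blockOf (m ∷ ps)) (Fin.toℕ-↑ʳ m (Inverse.to (enumerate ps) v))) (blockOf-tail m ps _)

↭⇒block-bijection : ∀ {N} ps qs → sumℕ ps ≡ N → sumℕ qs ≡ N → ps ↭ qs →
  Σ (Fin N ↔ Fin N) λ σ → ∀ i j → (toℕ i ≈[ ps ] toℕ j) ≡ (toℕ (Inverse.to σ i) ≈[ qs ] toℕ (Inverse.to σ j))
↭⇒block-bijection {N} ps qs Σps Σqs p with enumeration ps Σps | enumeration qs Σqs | Vertex-↭ p
  where
  -- Both lists must index the same `Fin N`, although their sums are only propositionally equal to
  -- `N`; the equation is matched here once.
  enumeration : ∀ ps → sumℕ ps ≡ N →
    Σ (Vertex ps ↔ Fin N) λ ε → ∀ v w → (toℕ (Inverse.to ε v) ≈[ ps ] toℕ (Inverse.to ε w)) ≡ sameBlock ps v w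
  enumeration ps refl = enumerate ps , blockOf-enumerate ps
... | ε , ε-same | η , η-same | σ , σ-same = ↔-trans (↔-sym ε) (↔-trans σ η) , λ i j → begin
  (toℕ i ≈[ ps ] toℕ j)
    ≡⟨ cong₂ (λ i j → toℕ i ≈[ ps ] toℕ j) (≡.sym (Inverse.strictlyInverseˡ ε i)) (≡.sym (Inverse.strictlyInverseˡ ε j)) ⟩
  (toℕ (Inverse.to ε (Inverse.from ε i)) ≈[ ps ] toℕ (Inverse.to ε (Inverse.from ε j)))
    ≡⟨ ε-same _ _ ⟩
  sameBlock ps (Inverse.from ε i) (Inverse.from ε j)
    ≡⟨ σ-same _ _ ⟩
  sameBlock qs (Inverse.to σ (Inverse.from ε i)) (Inverse.to σ (Inverse.from ε j))
    ≡⟨ ≡.sym (η-same _ _) ⟩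
  (toℕ (Inverse.to η (Inverse.to σ (Inverse.from ε i))) ≈[ qs ] toℕ (Inverse.to η (Inverse.to σ (Inverse.from ε j)))) ∎

≡ᵇ-injective : ∀ {m n} (f : Fin m → Fin n) → (∀ {i j} → f i ≡ f j → i ≡ j) →
  ∀ i j → (toℕ i ≡ᵇ toℕ j) ≡ (toℕ (f i) ≡ᵇ toℕ (f j))
≡ᵇ-injective f inj i j with i Fin.≟ j
... | yes refl = trans (≡ᵇ-refl (toℕ i)) (≡.sym (≡ᵇ-refl (toℕ (f i))))
... | no i≢j   = trans (≢⇒≡ᵇ-false i≢j) (≡.sym (≢⇒≡ᵇ-false (i≢j ∘ inj)))

↭⇒Isomorphic : ∀ {N} ps qs → sumℕ ps ≡ N → sumℕ qs ≡ N → ps ↭ qs → Isomorphic (K (suc N) ps) (K (suc N) qs)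
↭⇒Isomorphic ps qs Σps Σqs p with ↭⇒block-bijection ps qs Σps Σqs p
-- `lift₀` fixes vertex 0, so v goes to v, and its adjacencies compute.
... | σ , same = lift₀ σ , λ where
  zero    zero    → refl
  zero    (suc j) → refl
  (suc i) zero    → refl
  (suc i) (suc j) → cong₂ (λ e s → not e ∧ s)
    (≡ᵇ-injective (Inverse.to σ) (Injection.injective (↔⇒↣ σ)) i j) (same i j)

theorem3p5 : (n : ℕ) (ps qs : List ℕ) → InFamily n ps → InFamily n qs →
    DCospectral (K n ps) (K n qs) → Isomorphic (K n ps) (K n qs)
theorem3p5 zero    ps qs (_ , _ , Σps+1≡0) _ _ = contradiction (trans (ℕ.+-comm 1 (sumℕ ps)) Σps+1≡0) λ ()
theorem3p5 (suc N) (m ∷ ps) qs (_ , m≥1 ∷ ps≥1 , Σps+1) (_ , qs≥1 , Σqs+1) cospectral =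
  ↭⇒Isomorphic (m ∷ ps) qs Σps Σqs (DCospectral⇒↭ (m ∷ ps) qs 1≤N Σps Σqs (m≥1 ∷ ps≥1) qs≥1 cospectral)
  where
  Σps : sumℕ (m ∷ ps) ≡ N
  Σps = ℕ.suc-injective (trans (ℕ.+-comm 1 (sumℕ (m ∷ ps))) Σps+1)

  Σqs : sumℕ qs ≡ N
  Σqs = ℕ.suc-injective (trans (ℕ.+-comm 1 (sumℕ qs)) Σqs+1)

  1≤N : 1 ≤ N
  -- The nonempty first block provides the vertex besides v that the distance computation requires.
  1≤N = subst (1 ≤_) Σps (ℕ.≤-trans m≥1 (ℕ.m≤m+n m (sumℕ ps)))
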